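{- The problem $k$-SEPARATING VERTICES restricted to balanced 2-track interval graphs is W[1]-hard with parameters $k$ and $l$.
   Context: $k$-SEPARATING VERTICES: given a graph $H=(V,E)$ and two integers $k$ and $l$, decide whether there is a partition $V=X\cup S\cup Y$ of the vertices such that $|X|=l$, $|S|\le k$, and there is no edge between $X$ and $Y$. "With parameters $k$ and $l$" means that the pair $(k,l)$ is the parameter. The intersection graph of a family of sets has one vertex per member, two different members being adjacent iff they intersect; the family is a representation of the graph. A 2-track interval is the union of two intervals on two disjoint parallel lines (tracks), one interval on each track. A balanced 2-track interval graph is the intersection graph of a family of 2-track intervals in which the two intervals of each 2-track interval have the same length (intervals from different 2-track intervals may have different lengths). Such a representation of $H$ is given as part of the input. A parameterized problem is W[1]-hard if every problem in W[1] has an FPT reduction to it; equivalently, if $k$-CLIQUE in general graphs (parameter $k$) has an FPT reduction to it. An FPT reduction maps an instance $x$ with parameter $\kappa$ to an equivalent instance $x'$ with parameter $\kappa'$ in time $g(\kappa)\cdot|x|^{O(1)}$, with $\kappa'$ bounded by a function of $\kappa$ (all functions computable). -}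

module Defs where

open import Data.Bool using (Bool; true; false; if_then_else_)
open import Data.Fin using (Fin; zero; suc)
open import Data.Fin.Subset using (Subset; _∈_; _∪_; _∩_; ⊤; Empty; ∣_∣)
open import Data.Integer using (ℤ; +_; -[1+_])
open import Data.List using (List; []; _∷_; map; tabulate)
open import Data.Nat using (ℕ; zero; suc; _+_; _*_; _∸_; _^_; _≤_; _≤ᵇ_)
open import Data.Nat.Logarithm using (⌊log₂_⌋)
open import Data.Product using (Σ-syntax; ∃; ∃-syntax; _×_; _,_)
open import Data.Rational as ℚ using (ℚ)
open import Data.Vec using (Vec; []; _∷_; lookup; replicate; toList; _[_]≔_)
open import Data.Vec.Relation.Unary.All using (All)
open import Function.Bundles using (_⇔_)
open import Level using (0ℓ)
open import Relation.Binary.PropositionalEquality using (_≡_; _≢_)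
open import Relation.Nullary using (¬_)
open import Relation.Unary using (Pred; _≬_)

-- Machine model: WHILE programs over binary trees with natural numbers at
-- the leaves.  Every operation is charged the bit sizes of its operands and
-- of its result, so that running times agree with those of Turing machines
-- up to a polynomial.

data Val : Set where
  nat  : ℕ → Val
  pair : Val → Val → Val

-- A number is measured by its binary length.
‖_‖ : Val → ℕ
‖ nat n ‖    = suc ⌊log₂ n ⌋
‖ pair u v ‖ = suc (‖ u ‖ + ‖ v ‖)

-- r is the number of registers.
data Expr (r : ℕ) : Set where
  var            : Fin r → Expr r
  const          : ℕ → Expr r
  cons           : Expr r → Expr r → Expr r
  fst snd isPair : Expr r → Expr r
  add sub mul    : Expr r → Expr r → Expr r
  leq            : Expr r → Expr r → Expr r

Store : ℕ → Set
Store r = Vec Val r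

-- Operations are total: a pair used as a number counts as 0, and both
-- components of a number are 0.  Subtraction is truncated.

toNat : Val → ℕ
toNat (nat n)    = n
toNat (pair _ _) = 0

fstVal sndVal isPairVal : Val → Val
fstVal (nat _)       = nat 0
fstVal (pair u _)    = u
sndVal (nat _)       = nat 0
sndVal (pair _ v)    = v
isPairVal (nat _)    = nat 0
isPairVal (pair _ _) = nat 1

bit : Bool → ℕ
bit b = if b then 1 else 0

eval : ∀ {r} → Expr r → Store r → Val
eval (var x)    s = lookup s x
eval (const n)  s = nat n
eval (cons d e) s = pair (eval d s) (eval e s)
eval (fst e)    s = fstVal (eval e s)
eval (snd e)    s = sndVal (eval e s)
eval (isPair e) s = isPairVal (eval e s)
eval (add d e)  s = nat (toNat (eval d s) + toNat (eval e s))
eval (sub d e)  s = nat (toNat (eval d s) ∸ toNat (eval e s))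
eval (mul d e)  s = nat (toNat (eval d s) * toNat (eval e s))
eval (leq d e)  s = nat (bit (toNat (eval d s) ≤ᵇ toNat (eval e s)))

-- The sum of the sizes of the values of all subexpressions.
cost : ∀ {r} → Expr r → Store r → ℕ
cost e@(var _)    s = ‖ eval e s ‖
cost e@(const _)  s = ‖ eval e s ‖
cost e@(cons a b) s = ‖ eval e s ‖ + (cost a s + cost b s)
cost e@(fst a)    s = ‖ eval e s ‖ + cost a s
cost e@(snd a)    s = ‖ eval e s ‖ + cost a s
cost e@(isPair a) s = ‖ eval e s ‖ + cost a s
cost e@(add a b)  s = ‖ eval e s ‖ + (cost a s + cost b s)
cost e@(sub a b)  s = ‖ eval e s ‖ + (cost a s + cost b s)
cost e@(mul a b)  s = ‖ eval e s ‖ + (cost a s + cost b s)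
cost e@(leq a b)  s = ‖ eval e s ‖ + (cost a s + cost b s)

infix  5 _≔_
infixr 4 _⨾_

data Cmd (r : ℕ) : Set where
  _≔_   : Fin r → Expr r → Cmd r
  _⨾_   : Cmd r → Cmd r → Cmd r
  cond  : Expr r → Cmd r → Cmd r → Cmd r
  while : Expr r → Cmd r → Cmd r

False True : Val → Set
False v = v ≡ nat 0
True  v = v ≢ nat 0

-- ⟨ c , s ⟩⇓ s′ [ t ]: started in s, the command c halts in s′ after time t.

infix 3 ⟨_,_⟩⇓_[_]

data ⟨_,_⟩⇓_[_] {r : ℕ} : Cmd r → Store r → Store r → ℕ → Set where
  ⇓-assign : ∀ {x e s} →
    ⟨ x ≔ e , s ⟩⇓ s [ x ]≔ eval e s [ suc (cost e s) ]
  ⇓-seq : ∀ {c d s s′ s″ t u} →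
    ⟨ c , s ⟩⇓ s′ [ t ] → ⟨ d , s′ ⟩⇓ s″ [ u ] →
    ⟨ c ⨾ d , s ⟩⇓ s″ [ t + u ]
  ⇓-then : ∀ {e c d s s′ t} → True (eval e s) →
    ⟨ c , s ⟩⇓ s′ [ t ] →
    ⟨ cond e c d , s ⟩⇓ s′ [ suc (cost e s) + t ]
  ⇓-else : ∀ {e c d s s′ t} → False (eval e s) →
    ⟨ d , s ⟩⇓ s′ [ t ] →
    ⟨ cond e c d , s ⟩⇓ s′ [ suc (cost e s) + t ]
  ⇓-stop : ∀ {e c s} → False (eval e s) →
    ⟨ while e c , s ⟩⇓ s [ suc (cost e s) ]
  ⇓-loop : ∀ {e c s s′ s″ t u} → True (eval e s) →
    ⟨ c , s ⟩⇓ s′ [ t ] → ⟨ while e c , s′ ⟩⇓ s″ [ u ] →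
    ⟨ while e c , s ⟩⇓ s″ [ suc (cost e s) + (t + u) ]

record Program : Set where
  field
    registers-1 : ℕ
    body        : Cmd (suc registers-1)

-- Register 0 holds the input at the start and the output at the end; the
-- other registers start at 0.
Computes : Program → Val → Val → ℕ → Set
Computes p u v t =
  ∃[ s ] ⟨ body , u ∷ replicate registers-1 (nat 0) ⟩⇓ s [ t ] × lookup s zero ≡ v
  where open Program p

encodeList : List Val → Val
encodeList []       = nat 0
encodeList (v ∷ vs) = pair v (encodeList vs)

encodeVec : ∀ {r} → Vec ℕ r → Val
encodeVec ns = encodeList (map nat (toList ns))

Computable : ∀ {r} → (Vec ℕ r → ℕ) → Set
Computable f = ∃[ p ] ∀ ns → ∃[ t ] Computes p (encodeVec ns) (nat (f ns)) t

-- A decision problem whose parameter is an r-tuple of natural numbers.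
record ParamProblem (r : ℕ) : Set₁ where
  field
    Instance : Set
    encode   : Instance → Val
    param    : Instance → Vec ℕ r
    Yes      : Instance → Set

  size : Instance → ℕ
  size x = ‖ encode x ‖

record _≤fpt_ {r s} (P : ParamProblem r) (Q : ParamProblem s) : Set where
  private
    module P = ParamProblem P
    module Q = ParamProblem Q
  field
    program      : Program
    g            : Vec ℕ r → ℕ
    g-computable : Computable g
    exponent     : ℕ
    f            : Vec ℕ r → ℕ
    f-computable : Computable f
    reduces      : ∀ (x : P.Instance) → Σ[ y ∈ Q.Instance ]
      (∃[ t ] Computes program (P.encode x) (Q.encode y) t
              × t ≤ g (P.param x) * P.size x ^ exponent)
      × All (_≤ f (P.param x)) (Q.param y)
      × (P.Yes x ⇔ Q.Yes y)

record Graph (n : ℕ) : Set where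
  field
    adj     : Fin n → Fin n → Bool
    sym     : ∀ u v → adj u v ≡ adj v u
    irrefl  : ∀ v → adj v v ≡ false

  Adjacent : Fin n → Fin n → Set
  Adjacent u v = adj u v ≡ true

open Graph using (Adjacent)

encodeFamily : ∀ {n} {A : Set} → (A → Val) → (Fin n → A) → Val
encodeFamily enc a = encodeList (tabulate (λ i → enc (a i)))

encodeGraph : ∀ {n} → Graph n → Val
encodeGraph G = encodeFamily (encodeFamily (λ b → nat (bit b))) (Graph.adj G)

HasClique : ∀ {n} → Graph n → ℕ → Set
HasClique {n} G k = Σ[ C ∈ Subset n ]
  ∣ C ∣ ≡ k × (∀ u v → u ∈ C → v ∈ C → u ≢ v → Adjacent G u v)

record CliqueInstance : Set where
  field
    {order} : ℕ
    graph   : Graph order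
    k       : ℕ

k-CLIQUE : ParamProblem 1
k-CLIQUE = record
  { Instance = CliqueInstance
  ; encode   = λ x → let open CliqueInstance x in pair (encodeGraph graph) (nat k)
  ; param    = λ x → let open CliqueInstance x in k ∷ []
  ; Yes      = λ x → let open CliqueInstance x in HasClique graph k
  }

-- W[1]-hardness, through the W[1]-complete problem k-CLIQUE.
W[1]-hard : ∀ {r} → ParamProblem r → Set
W[1]-hard Q = k-CLIQUE ≤fpt Q

HasSeparation : ∀ {n} → Graph n → ℕ → ℕ → Set
HasSeparation {n} H k l =
  Σ[ X ∈ Subset n ] Σ[ S ∈ Subset n ] Σ[ Y ∈ Subset n ]
    X ∪ S ∪ Y ≡ ⊤
  × Empty (X ∩ S) × Empty (X ∩ Y) × Empty (S ∩ Y)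
  × ∣ X ∣ ≡ l
  × ∣ S ∣ ≤ k
  × (∀ u v → u ∈ X → v ∈ Y → ¬ Adjacent H u v)

Represents : ∀ {n} {A : Set} → (Fin n → Pred A 0ℓ) → Graph n → Set
Represents F H = ∀ i j → i ≢ j → Adjacent H i j ⇔ (F i ≬ F j)

-- Closed intervals.  Endpoints are rational because a representation is
-- part of the input; two such intervals meet in a real point iff they meet
-- in a rational one.
record Interval : Set where
  field
    lo hi : ℚ
    lo≤hi : lo ℚ.≤ hi

  length : ℚ
  length = hi ℚ.- lo

open Interval using (lo; hi; length)

Track : Set
Track = Fin 2

TwoTrackInterval : Set
TwoTrackInterval = Track → Interval

-- The underlying set of points, in the disjoint union of the two lines.
points : TwoTrackInterval → Pred (Track × ℚ) 0ℓ
points D (τ , x) = lo (D τ) ℚ.≤ x × x ℚ.≤ hi (D τ)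

Balanced : TwoTrackInterval → Set
Balanced D = length (D zero) ≡ length (D (suc zero))

record BalancedRepresentation {n} (H : Graph n) : Set where
  field
    family     : Fin n → TwoTrackInterval
    balanced   : ∀ i → Balanced (family i)
    represents : Represents (λ i → points (family i)) H

encodeℤ : ℤ → Val
encodeℤ (+ n)    = pair (nat 0) (nat n)
encodeℤ -[1+ n ] = pair (nat 1) (nat (suc n))

encodeℚ : ℚ → Val
encodeℚ q = pair (encodeℤ (ℚ.numerator q)) (nat (ℚ.denominatorℕ q))

encodeInterval : Interval → Val
encodeInterval I = pair (encodeℚ (lo I)) (encodeℚ (hi I))

encodeTwoTrack : TwoTrackInterval → Val
encodeTwoTrack D = pair (encodeInterval (D zero)) (encodeInterval (D (suc zero)))

record SeparationInstance : Set where
  field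
    {order}        : ℕ
    graph          : Graph order
    representation : BalancedRepresentation graph
    k l            : ℕ

  open BalancedRepresentation representation public

k-SEPARATING-VERTICES-balanced-2-track : ParamProblem 2
k-SEPARATING-VERTICES-balanced-2-track = record
  { Instance = SeparationInstance
  ; encode   = λ x → let open SeparationInstance x in
      pair (pair (encodeGraph graph) (encodeFamily encodeTwoTrack family))
           (pair (nat k) (nat l))
  ; param    = λ x → let open SeparationInstance x in k ∷ l ∷ []
  ; Yes      = λ x → let open SeparationInstance x in HasSeparation graph k l
  }

{-# OPTIONS --safe #-}
module Submission where

-- From (G , k) with n vertices, first replace k by min(k, n + 1), which does not
-- affect the existence of a k-clique.  On either track every vertex u of G owns a
-- cell of n + 1 integer points.  H has a vertex spanning the cell of u on both
-- tracks, more than k² + k copies of the first point of that cell (blockers), and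
-- for each pair (u , v) with u = v or u adjacent to v an arc: a point of the cell
-- of u on the first track together with a point of the cell of v on the second,
-- all these points being distinct.  If |X| = k², |S| ≤ k and X has no edge to the
-- rest, then X avoids blockers and spanning vertices, since these have too many
-- neighbours; so X consists of k² arcs, whose endpoints all lie in S.  Hence there
-- are exactly k endpoints and every pair of them is an arc, i.e. they form a clique.
-- Conversely a clique C yields X = C × C and S = C.
--
-- The reduction is polynomial in its entire input.  Functions are shown to be
-- polynomial time by closure properties, the essential one being iteration along a
-- list whose accumulator is controlled by a potential.

open import Data.Bool using (Bool; true; false; _∧_)
import Data.Bool.Properties as Bool
open import Data.Fin using (Fin; zero; suc; toℕ; opposite; splitAt; remQuot; combine; _↑ˡ_; _↑ʳ_; _≟_)
open import Data.Fin.Properties using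
  ( toℕ-injective; toℕ<n; toℕ-fromℕ; toℕ-inject₁; toℕ-↑ˡ; toℕ-↑ʳ; opposite-prop; opposite-involutive
  ; splitAt-↑ˡ; splitAt-↑ʳ; splitAt⁻¹-↑ʳ; splitAt⁻¹-↑ˡ; ↑ˡ-injective; ↑ʳ-injective; suc-injective
  ; remQuot-combine; combine-remQuot; combine-injective; combine-surjective; injective⇒≤)
open import Data.Fin.Subset using (Subset; _∈_; _∉_; _∪_; ∁; ⊤; ∣_∣; inside; outside)
open import Data.Fin.Subset.Properties using
  (x∈p∪q⁻; x∈p∪q⁺; ∈⊤; x∈p∩q⁻; x∈∁p⇒x∉p; ∪-assoc; p∪∁p≡⊤; ∣p∣≤n)
import Data.Integer as ℤ
import Data.Integer.Properties as ℤ
open import Data.List using ([]; _∷_; tabulate; foldl; foldr; reverse)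
open import Data.List.Properties using (reverse-foldr; reverse-foldl; tabulate-cong)
import Data.Nat.Coprimality as Coprime
open import Data.Nat hiding (_≟_)
open import Data.Nat.Induction using (<-wellFounded)
open import Data.Nat.Logarithm using (⌊log₂_⌋; ⌊log₂⌋-mono-≤; ⌊log₂[2^n]⌋≡n)
open import Data.Nat.Logarithm.Core using (⌊log2⌋)
open import Data.Nat.Properties as ℕ hiding (_≟_; suc-injective)
open import Data.Nat.Solver using (module +-*-Solver)
open import Data.Product using (∃-syntax; _×_; _,_; proj₁; proj₂; uncurry)
open import Data.Rational as ℚ using (ℚ; mkℚ; *≤*)
import Data.Rational.Properties as ℚ
open import Data.Rational.Unnormalised using (*≡*)
import Data.Rational.Unnormalised.Properties as ℚᵘ
open import Data.Sum as Sum using (_⊎_; inj₁; inj₂; [_,_]′)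
open import Data.Vec as Vec using (Vec; []; _∷_; lookup; _[_]≔_; here; there)
open import Data.Vec.Properties using (lookup⇒[]=; []=⇒lookup; lookup∘tabulate)
open import Data.Vec.Relation.Unary.All using ([]; _∷_)
open import Function using (_∘_; id; flip)
open import Function.Bundles using (_⇔_; mk⇔; Equivalence)
import Function.Properties.Equivalence as ⇔
open import Induction.WellFounded using (Acc; acc)
open import Relation.Binary.Definitions using (tri<; tri≈; tri>)
open import Relation.Binary.PropositionalEquality
open import Relation.Nullary using (¬_; yes; no; contradiction; Dec)
open import Relation.Nullary.Decidable using (_⊎-dec_)
open import Relation.Unary using (_≬_)

open import Defs

open +-*-Solver using (solve; _:=_; con; _:+_; _:*_)
open Equivalence using (to; from)

-- Polynomial bounds

-- The induction follows the recursion of the logarithm, from `2 + n` to `1 + ⌊ n /2⌋`. The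
-- accessibility proof is a variable of `go`, so that whichever proof this recursion produces is
-- covered.
n<2^suc⌊log₂n⌋ : ∀ n → n < 2 ^ suc ⌊log₂ n ⌋
n<2^suc⌊log₂n⌋ n = go n (<-wellFounded n)
  where
  go : ∀ n (a : Acc _<_ n) → n < 2 ^ suc (⌊log2⌋ n a)
  go 0 _ = s≤s z≤n
  go 1 _ = s≤s (s≤s z≤n)
  go (suc (suc n)) (acc rs) = begin-strict
    suc (suc n)                          ≡⟨ cong (2 +_) (⌊n/2⌋+⌈n/2⌉≡n n) ⟨
    2 + (⌊ n /2⌋ + ⌈ n /2⌉)              ≤⟨ +-monoʳ-≤ 2 (+-monoʳ-≤ ⌊ n /2⌋ (⌊n/2⌋-mono (n≤1+n (suc n)))) ⟩
    2 + (⌊ n /2⌋ + suc ⌊ n /2⌋)          <⟨ ≤-reflexive (solve 1 (λ h → con 1 :+ (con 2 :+ (h :+ (con 1 :+ h))) := con 2 :* (con 2 :+ h)) refl ⌊ n /2⌋) ⟩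
    2 * suc (suc ⌊ n /2⌋)                ≤⟨ *-monoʳ-≤ 2 (go (suc ⌊ n /2⌋) _) ⟩
    2 ^ suc (⌊log2⌋ (suc (suc n)) (acc rs)) ∎
    where open ≤-Reasoning

⌊log₂⌋-≤ : ∀ {n k} → n ≤ 2 ^ k → ⌊log₂ n ⌋ ≤ k
⌊log₂⌋-≤ {n} {k} n≤2^k = subst (⌊log₂ n ⌋ ≤_) (⌊log₂[2^n]⌋≡n k) (⌊log₂⌋-mono-≤ n≤2^k)

‖nat‖-mono : ∀ {m n} → m ≤ n → ‖ nat m ‖ ≤ ‖ nat n ‖
‖nat‖-mono m≤n = s≤s (⌊log₂⌋-mono-≤ m≤n)

1≤‖_‖ : ∀ v → 1 ≤ ‖ v ‖
1≤‖ nat _ ‖    = s≤s z≤n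
1≤‖ pair _ _ ‖ = s≤s z≤n

‖nat‖≤suc : ∀ n → ‖ nat n ‖ ≤ suc n
‖nat‖≤suc n = s≤s (⌊log₂⌋-≤ (n≤2^n n))
  where
  n≤2^n : ∀ n → n ≤ 2 ^ n
  n≤2^n zero    = z≤n
  n≤2^n (suc n) = begin
    1 + n              ≤⟨ +-mono-≤ (m^n>0 2 n) (n≤2^n n) ⟩
    2 ^ n + 2 ^ n      ≡⟨ cong (2 ^ n +_) (+-identityʳ _) ⟨
    2 ^ suc n          ∎
    where open ≤-Reasoning

-- The lengths `a` and `b` are positive, so each of `2 ^ a` and `2 ^ b` is at most half of
-- `2 ^ (a + b)`.
‖nat-+‖ : ∀ m n → ‖ nat (m + n) ‖ ≤ suc (‖ nat m ‖ + ‖ nat n ‖)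
‖nat-+‖ m n = s≤s (⌊log₂⌋-≤ (begin
  m + n                  ≤⟨ +-mono-≤ (<⇒≤ (n<2^suc⌊log₂n⌋ m)) (<⇒≤ (n<2^suc⌊log₂n⌋ n)) ⟩
  2 ^ a + 2 ^ b          ≤⟨ +-mono-≤ (^-monoʳ-≤ 2 (m≤m+n a ⌊log₂ n ⌋)) (^-monoʳ-≤ 2 (s≤s (m≤n+m ⌊log₂ n ⌋ ⌊log₂ m ⌋))) ⟩
  2 ^ c + 2 ^ c          ≡⟨ cong (2 ^ c +_) (+-identityʳ _) ⟨
  2 ^ suc c              ≡⟨ cong (λ z → 2 ^ suc z) (+-suc ⌊log₂ m ⌋ ⌊log₂ n ⌋) ⟨
  2 ^ (a + b)            ∎))
  where
  open ≤-Reasoning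
  a = suc ⌊log₂ m ⌋
  b = suc ⌊log₂ n ⌋
  c = suc (⌊log₂ m ⌋ + ⌊log₂ n ⌋)

‖nat-*‖ : ∀ m n → ‖ nat (m * n) ‖ ≤ suc (‖ nat m ‖ + ‖ nat n ‖)
‖nat-*‖ m n = s≤s (⌊log₂⌋-≤ (begin
  m * n                                  ≤⟨ *-mono-≤ (<⇒≤ (n<2^suc⌊log₂n⌋ m)) (<⇒≤ (n<2^suc⌊log₂n⌋ n)) ⟩
  2 ^ suc ⌊log₂ m ⌋ * 2 ^ suc ⌊log₂ n ⌋  ≡⟨ ^-distribˡ-+-* 2 (suc ⌊log₂ m ⌋) (suc ⌊log₂ n ⌋) ⟨
  2 ^ (suc ⌊log₂ m ⌋ + suc ⌊log₂ n ⌋)    ∎))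
  where open ≤-Reasoning

‖toNat‖ : ∀ v → ‖ nat (toNat v) ‖ ≤ ‖ v ‖
‖toNat‖ (nat n)    = ≤-refl
‖toNat‖ (pair u v) = s≤s z≤n

‖fstVal‖ : ∀ v → ‖ fstVal v ‖ ≤ ‖ v ‖
‖fstVal‖ (nat n)    = s≤s z≤n
‖fstVal‖ (pair u v) = m≤n⇒m≤1+n (m≤m+n ‖ u ‖ ‖ v ‖)

‖sndVal‖ : ∀ v → ‖ sndVal v ‖ ≤ ‖ v ‖
‖sndVal‖ (nat n)    = s≤s z≤n
‖sndVal‖ (pair u v) = m≤n⇒m≤1+n (m≤n+m ‖ v ‖ ‖ u ‖)

‖isPairVal‖ : ∀ v → ‖ isPairVal v ‖ ≤ ‖ v ‖
‖isPairVal‖ (nat n)    = s≤s z≤n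
‖isPairVal‖ (pair u v) = s≤s z≤n

-- b ≼ s: b is polynomially bounded in s.  Since 2 ≤ 2 + s, a single power
-- absorbs all coefficients and lower-order terms.
infix 4 _≼_

record _≼_ {A : Set} (b s : A → ℕ) : Set where
  constructor _,_
  field
    degree : ℕ
    bound  : ∀ a → b a ≤ (2 + s a) ^ degree

module _ {A : Set} {s : A → ℕ} where

  ≼-mono : ∀ {b c} → (∀ a → b a ≤ c a) → c ≼ s → b ≼ s
  ≼-mono b≤c (e , p) = e , λ a → ≤-trans (b≤c a) (p a)

  ≼-self : s ≼ s
  ≼-self = 1 , λ a → ≤-trans (m≤n+m (s a) 2) (≤-reflexive (sym (*-identityʳ (2 + s a))))

  ≼-* : ∀ {b c} → b ≼ s → c ≼ s → (λ a → b a * c a) ≼ s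
  ≼-* {b} {c} (d , p) (e , q) = d + e , λ a → begin
    b a * c a                      ≤⟨ *-mono-≤ (p a) (q a) ⟩
    (2 + s a) ^ d * (2 + s a) ^ e  ≡⟨ ^-distribˡ-+-* (2 + s a) d e ⟨
    (2 + s a) ^ (d + e)            ∎
    where open ≤-Reasoning

  ≼-+ : ∀ {b c} → b ≼ s → c ≼ s → (λ a → b a + c a) ≼ s
  ≼-+ {b} {c} (d , p) (e , q) = suc (d + e) , λ a → let x = 2 + s a in begin
    b a + c a                  ≤⟨ +-mono-≤ (p a) (q a) ⟩
    x ^ d + x ^ e              ≤⟨ +-mono-≤ (^-monoʳ-≤ x (m≤m+n d e)) (^-monoʳ-≤ x (m≤n+m e d)) ⟩
    x ^ (d + e) + x ^ (d + e)  ≡⟨ cong (x ^ (d + e) +_) (+-identityʳ _) ⟨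
    2 * x ^ (d + e)            ≤⟨ *-monoˡ-≤ (x ^ (d + e)) (m≤m+n 2 (s a)) ⟩
    x ^ suc (d + e)            ∎
    where open ≤-Reasoning

  ≼-const : ∀ n → (λ _ → n) ≼ s
  ≼-const zero          = 0 , λ _ → z≤n
  ≼-const (suc zero)    = 0 , λ _ → ≤-refl
  ≼-const (suc n@(suc _)) = ≼-+ (≼-const 1) (≼-const n)

  ≼-^ : ∀ {b} e → b ≼ s → (λ a → b a ^ e) ≼ s
  ≼-^ zero    p = ≼-const 1
  ≼-^ (suc e) p = ≼-* p (≼-^ e p)

≼-∘ : ∀ {A B : Set} {b s : B → ℕ} {s′ : A → ℕ} (h : A → B) →
      b ≼ s → s ∘ h ≼ s′ → b ∘ h ≼ s′
≼-∘ h (e , p) q = ≼-mono (λ a → p (h a)) (≼-^ e (≼-+ (≼-const 2) q))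

-- Memory growth against running time

storeSize : ∀ {r} → Store r → ℕ
storeSize []      = 0
storeSize (v ∷ s) = ‖ v ‖ + storeSize s

storeSize-update : ∀ {r} (s : Store r) x v → storeSize (s [ x ]≔ v) ≤ storeSize s + ‖ v ‖
storeSize-update (u ∷ s) zero v = begin
  ‖ v ‖ + storeSize s            ≡⟨ +-comm ‖ v ‖ (storeSize s) ⟩
  storeSize s + ‖ v ‖            ≤⟨ +-monoˡ-≤ ‖ v ‖ (m≤n+m (storeSize s) ‖ u ‖) ⟩
  ‖ u ‖ + storeSize s + ‖ v ‖    ∎
  where open ≤-Reasoning
storeSize-update (u ∷ s) (suc x) v = begin
  ‖ u ‖ + storeSize (s [ x ]≔ v)   ≤⟨ +-monoʳ-≤ ‖ u ‖ (storeSize-update s x v) ⟩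
  ‖ u ‖ + (storeSize s + ‖ v ‖)    ≡⟨ +-assoc ‖ u ‖ _ _ ⟨
  ‖ u ‖ + storeSize s + ‖ v ‖      ∎
  where open ≤-Reasoning

‖eval‖≤cost : ∀ {r} (e : Expr r) s → ‖ eval e s ‖ ≤ cost e s
‖eval‖≤cost (var _)    s = ≤-refl
‖eval‖≤cost (const _)  s = ≤-refl
‖eval‖≤cost (cons _ _) s = m≤m+n _ _
‖eval‖≤cost (fst _)    s = m≤m+n _ _
‖eval‖≤cost (snd _)    s = m≤m+n _ _
‖eval‖≤cost (isPair _) s = m≤m+n _ _
‖eval‖≤cost (add _ _)  s = m≤m+n _ _
‖eval‖≤cost (sub _ _)  s = m≤m+n _ _
‖eval‖≤cost (mul _ _)  s = m≤m+n _ _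
‖eval‖≤cost (leq _ _)  s = m≤m+n _ _

-- An assignment is charged at least the size of the value it writes, so memory grows no faster than
-- time passes. A time bound therefore also bounds the output, which is what composition needs.
growth≤time : ∀ {r} {c : Cmd r} {s s′ t} → ⟨ c , s ⟩⇓ s′ [ t ] → storeSize s′ ≤ storeSize s + t
growth≤time {s = s} (⇓-assign {x} {e}) =
  ≤-trans (storeSize-update s x (eval e s))
          (+-monoʳ-≤ (storeSize s) (m≤n⇒m≤1+n (‖eval‖≤cost e s)))
growth≤time {s = s} (⇓-seq {s′ = s′} {t = t} {u} p q) = begin
  _                          ≤⟨ growth≤time q ⟩
  storeSize s′ + u           ≤⟨ +-monoˡ-≤ u (growth≤time p) ⟩
  storeSize s + t + u        ≡⟨ +-assoc (storeSize s) t u ⟩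
  storeSize s + (t + u)      ∎
  where open ≤-Reasoning
growth≤time {s = s} (⇓-then {t = t} _ p) =
  ≤-trans (growth≤time p) (+-monoʳ-≤ (storeSize s) (m≤n+m t _))
growth≤time {s = s} (⇓-else {t = t} _ p) =
  ≤-trans (growth≤time p) (+-monoʳ-≤ (storeSize s) (m≤n+m t _))
growth≤time {s = s} (⇓-stop _) = m≤m+n (storeSize s) _
growth≤time {s = s} (⇓-loop {e} {s′ = s′} {t = t} {u} _ p q) = begin
  _                          ≤⟨ growth≤time q ⟩
  storeSize s′ + u           ≤⟨ +-monoˡ-≤ u (growth≤time p) ⟩
  storeSize s + t + u        ≡⟨ +-assoc (storeSize s) t u ⟩
  storeSize s + (t + u)      ≤⟨ +-monoʳ-≤ (storeSize s) (m≤n+m (t + u) (suc (cost e s))) ⟩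
  storeSize s + (suc (cost e s) + (t + u)) ∎
  where open ≤-Reasoning

-- Polynomial-time functions on values

-- The first component is the value being computed on, the second a stack.
State : Set
State = Val × Val

⟦_⟧ : State → Store 2
⟦ v , k ⟧ = v ∷ k ∷ []

∣_∣ₛ : State → ℕ
∣ v , k ∣ₛ = ‖ v ‖ + ‖ k ‖

-- The degrees found here and below are astronomical; abstract prevents their evaluation.
abstract
  -- Every operation returns a value at most one larger than its operands together. The expression
  -- is fixed, so the degree may grow with its depth.
  cost-≼ : (e : Expr 2) → (λ s → cost e ⟦ s ⟧) ≼ ∣_∣ₛ
  ‖eval‖-≼ : (e : Expr 2) → (λ s → ‖ eval e ⟦ s ⟧ ‖) ≼ ∣_∣ₛ
  ‖eval‖-≼ e = ≼-mono (λ s → ‖eval‖≤cost e ⟦ s ⟧) (cost-≼ e)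

  unary-≼ : ∀ {op : Val → Val} → (∀ v → ‖ op v ‖ ≤ ‖ v ‖) → (e : Expr 2) →
            (λ s → ‖ op (eval e ⟦ s ⟧) ‖ + cost e ⟦ s ⟧) ≼ ∣_∣ₛ
  unary-≼ op≤ e = ≼-+ (≼-mono (λ s → op≤ (eval e ⟦ s ⟧)) (‖eval‖-≼ e)) (cost-≼ e)

  binary-≼ : (op : Val → Val → Val) → (∀ u v → ‖ op u v ‖ ≤ suc (‖ u ‖ + ‖ v ‖)) → (d e : Expr 2) →
             (λ s → ‖ op (eval d ⟦ s ⟧) (eval e ⟦ s ⟧) ‖ + (cost d ⟦ s ⟧ + cost e ⟦ s ⟧)) ≼ ∣_∣ₛ
  binary-≼ op op≤ d e =
    ≼-+ (≼-mono (λ s → op≤ (eval d ⟦ s ⟧) (eval e ⟦ s ⟧))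
                (≼-+ (≼-const 1) (≼-+ (‖eval‖-≼ d) (‖eval‖-≼ e))))
        (≼-+ (cost-≼ d) (cost-≼ e))

  numeric-≼ : (op : ℕ → ℕ → ℕ) → (∀ m n → ‖ nat (op m n) ‖ ≤ suc (‖ nat m ‖ + ‖ nat n ‖)) →
              (d e : Expr 2) →
              (λ s → ‖ nat (op (toNat (eval d ⟦ s ⟧)) (toNat (eval e ⟦ s ⟧))) ‖
                     + (cost d ⟦ s ⟧ + cost e ⟦ s ⟧)) ≼ ∣_∣ₛ
  numeric-≼ op op≤ = binary-≼ (λ u v → nat (op (toNat u) (toNat v)))
    λ u v → ≤-trans (op≤ (toNat u) (toNat v)) (s≤s (+-mono-≤ (‖toNat‖ u) (‖toNat‖ v)))

  cost-≼ (var zero)       = ≼-mono (λ s → m≤m+n _ _) ≼-self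
  cost-≼ (var (suc zero)) = ≼-mono (λ (v , _) → m≤n+m _ ‖ v ‖) ≼-self
  cost-≼ (const n)  = ≼-const ‖ nat n ‖
  cost-≼ (cons d e) = binary-≼ pair (λ _ _ → ≤-refl) d e
  cost-≼ (fst e)    = unary-≼ ‖fstVal‖ e
  cost-≼ (snd e)    = unary-≼ ‖sndVal‖ e
  cost-≼ (isPair e) = unary-≼ ‖isPairVal‖ e
  cost-≼ (add d e)  = numeric-≼ _+_ ‖nat-+‖ d e
  cost-≼ (mul d e)  = numeric-≼ _*_ ‖nat-*‖ d e
  cost-≼ (sub d e)  = numeric-≼ _∸_ (λ m n →
    ≤-trans (‖nat‖-mono (m∸n≤m m n)) (m≤n⇒m≤1+n (m≤m+n _ _))) d e
  cost-≼ (leq d e)  = numeric-≼ (λ m n → bit (m ≤ᵇ n)) (λ m n →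
    ≤-trans (‖bit‖ (m ≤ᵇ n)) (s≤s z≤n)) d e
    where
    ‖bit‖ : ∀ b → ‖ nat (bit b) ‖ ≤ 1
    ‖bit‖ true  = ≤-refl
    ‖bit‖ false = ≤-refl

record Realizable (h : State → State) : Set where
  field
    command : Cmd 2
    time    : State → ℕ
    runs    : ∀ s → ⟨ command , ⟦ s ⟧ ⟩⇓ ⟦ h s ⟧ [ time s ]
    time-≼  : time ≼ ∣_∣ₛ

open Realizable

storeSize-⟦⟧ : ∀ s → storeSize ⟦ s ⟧ ≡ ∣ s ∣ₛ
storeSize-⟦⟧ (v , k) = cong (‖ v ‖ +_) (+-identityʳ ‖ k ‖)

size-≼ : ∀ {h} → Realizable h → ∣_∣ₛ ∘ h ≼ ∣_∣ₛ
size-≼ {h} p = ≼-mono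
  (λ s → subst₂ (λ a b → a ≤ b + time p s) (storeSize-⟦⟧ (h s)) (storeSize-⟦⟧ s) (growth≤time (runs p s)))
  (≼-+ ≼-self (time-≼ p))

infixl 4 _▸_

_▸_ : ∀ {g h} → Realizable g → Realizable h → Realizable (h ∘ g)
_▸_ {g} p q = record
  { command = command p ⨾ command q
  ; time    = λ s → time p s + time q (g s)
  ; runs    = λ s → ⇓-seq (runs p s) (runs q (g s))
  ; time-≼  = ≼-+ (time-≼ p) (≼-∘ g (time-≼ q) (size-≼ p))
  }

abstract
  val≔ : (e : Expr 2) → Realizable (λ s → eval e ⟦ s ⟧ , proj₂ s)
  val≔ e = record
    { command = zero ≔ e
    ; time    = λ s → suc (cost e ⟦ s ⟧)
    ; runs    = λ s → ⇓-assign
    ; time-≼  = ≼-+ (≼-const 1) (cost-≼ e)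
    }

  stk≔ : (e : Expr 2) → Realizable (λ s → proj₁ s , eval e ⟦ s ⟧)
  stk≔ e = record
    { command = suc zero ≔ e
    ; time    = λ s → suc (cost e ⟦ s ⟧)
    ; runs    = λ s → ⇓-assign
    ; time-≼  = ≼-+ (≼-const 1) (cost-≼ e)
    }

onVal : (Val → Val) → State → State
onVal F (v , k) = F v , k

-- The stack is arbitrary and has to be restored, so that values needed later can wait on it during
-- the computation.
PolyTime : (Val → Val) → Set
PolyTime F = Realizable (onVal F)

‖_‖-≼ : ∀ {F} → PolyTime F → (‖_‖ ∘ F) ≼ ‖_‖
‖_‖-≼ {F} p = ≼-mono (λ v → m≤m+n ‖ F v ‖ ‖ nat 0 ‖)
  (≼-∘ (_, nat 0) (size-≼ p) (≼-+ ≼-self (≼-const ‖ nat 0 ‖)))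

weaken : Expr 1 → Expr 2
weaken (var _)    = var zero
weaken (const n)  = const n
weaken (cons d e) = cons (weaken d) (weaken e)
weaken (fst e)    = fst (weaken e)
weaken (snd e)    = snd (weaken e)
weaken (isPair e) = isPair (weaken e)
weaken (add d e)  = add (weaken d) (weaken e)
weaken (sub d e)  = sub (weaken d) (weaken e)
weaken (mul d e)  = mul (weaken d) (weaken e)
weaken (leq d e)  = leq (weaken d) (weaken e)

eval-weaken : ∀ e v k → eval (weaken e) ⟦ v , k ⟧ ≡ eval e (v ∷ [])
eval-weaken (var zero) v k = refl
eval-weaken (const n)  v k = refl
eval-weaken (cons d e) v k = cong₂ pair (eval-weaken d v k) (eval-weaken e v k)
eval-weaken (fst e)    v k = cong fstVal (eval-weaken e v k)
eval-weaken (snd e)    v k = cong sndVal (eval-weaken e v k)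
eval-weaken (isPair e) v k = cong isPairVal (eval-weaken e v k)
eval-weaken (add d e)  v k = cong₂ (λ x y → nat (toNat x + toNat y)) (eval-weaken d v k) (eval-weaken e v k)
eval-weaken (sub d e)  v k = cong₂ (λ x y → nat (toNat x ∸ toNat y)) (eval-weaken d v k) (eval-weaken e v k)
eval-weaken (mul d e)  v k = cong₂ (λ x y → nat (toNat x * toNat y)) (eval-weaken d v k) (eval-weaken e v k)
eval-weaken (leq d e)  v k = cong₂ (λ x y → nat (bit (toNat x ≤ᵇ toNat y))) (eval-weaken d v k) (eval-weaken e v k)

Realizable-cong : ∀ {g h} → (∀ s → g s ≡ h s) → Realizable g → Realizable h
Realizable-cong g≗h p = record
  { command = command p
  ; time    = time p
  ; runs    = λ s → subst (λ s′ → ⟨ command p , ⟦ s ⟧ ⟩⇓ ⟦ s′ ⟧ [ time p s ]) (g≗h s) (runs p s)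
  ; time-≼  = time-≼ p
  }

PolyTime-cong : ∀ {F G} → (∀ v → F v ≡ G v) → PolyTime F → PolyTime G
PolyTime-cong F≗G = Realizable-cong λ (v , k) → cong (_, k) (F≗G v)

arg : Expr 1
arg = var zero

⟨_⟩ : Expr 1 → Val → Val
⟨ e ⟩ v = eval e (v ∷ [])

abstract
  expr : ∀ e → PolyTime ⟨ e ⟩
  expr e = Realizable-cong (λ (v , k) → cong (_, k) (eval-weaken e v k)) (val≔ (weaken e))

infixr 9 _∘ₚ_

abstract
  _∘ₚ_ : ∀ {F G} → PolyTime G → PolyTime F → PolyTime (G ∘ F)
  q ∘ₚ p = p ▸ q

infixr 4 _,ₚ_

abstract
  _,ₚ_ : ∀ {F G} → PolyTime F → PolyTime G → PolyTime (λ v → pair (F v) (G v))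
  p ,ₚ q =
      -- The input is saved on the stack while `p` runs, then exchanged with the result of `p`,
      -- which waits there while `q` runs on the input.
      stk≔ (cons v k) ▸ p
    ▸ stk≔ (cons (fst k) (cons v (snd k))) ▸ val≔ (fst k) ▸ stk≔ (snd k) ▸ q
    ▸ val≔ (cons (fst k) v) ▸ stk≔ (snd k)
    where
    v k : Expr 2
    v = var zero
    k = var (suc zero)

-- Iteration along lists

len : Val → ℕ
len (nat _)     = 0
len (pair _ vs) = suc (len vs)

len≤‖_‖ : ∀ v → len v ≤ ‖ v ‖
len≤‖ nat _ ‖    = z≤n
len≤‖ pair u v ‖ = s≤s (≤-trans len≤‖ v ‖ (m≤n+m ‖ v ‖ ‖ u ‖))

foldVal : (Val → Val) → Val → Val → Val → Val
foldVal step e (nat _)     a = a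
foldVal step e (pair x xs) a = foldVal step e xs (step (pair e (pair x a)))

π₁ π₂ π₃ : Val → Val
π₁ w   = fstVal w
π₂ w = fstVal (sndVal w)
π₃ w = sndVal (sndVal w)

-- Iterating a polynomial-time step need not take polynomial time; a potential
-- certifies that the accumulator stays small throughout.
record Potential (step : Val → Val) : Set where
  field
    potential  : Val → Val → Val → ℕ
    acc≤       : ∀ e xs a → ‖ a ‖ ≤ potential e xs a
    decreasing : ∀ e x xs a → potential e xs (step (pair e (pair x a))) ≤ potential e (pair x xs) a
    potential-≼ : (λ w → potential (π₁ w) (π₂ w) (π₃ w)) ≼ ‖_‖

-- Loop states have the form `pair e (pair xs a)`; the test asks whether an entry of `xs` remains.
guard : Expr 2
guard = isPair (fst (snd (var zero)))

round : (Val → Val) → Val → Val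
round step w = pair (π₁ w) (pair (sndVal (π₂ w)) (step (pair (π₁ w) (pair (fstVal (π₂ w)) (π₃ w)))))

roundₚ : ∀ {step} → PolyTime step → PolyTime (round step)
roundₚ stepₚ = expr (fst arg) ,ₚ expr (snd (fst (snd arg))) ,ₚ
               stepₚ ∘ₚ expr (cons (fst arg) (cons (fst (fst (snd arg))) (snd (snd arg))))

-- The projections default to `nat 0` on malformed values. Rebuilding the triple first puts every
-- input into the shape that the loop invariant assumes.
triple : Val → Val
triple w = pair (π₁ w) (pair (π₂ w) (π₃ w))

module Loop {step : Val → Val} (pot : Potential step)
            (body : PolyTime (round step)) (prepare : PolyTime triple)
            (guard-≼ : (λ s → cost guard ⟦ s ⟧) ≼ ∣_∣ₛ) where
  open Potential pot
  open _≼_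

  private
    loop : Cmd 2
    loop = while guard (command body)

    end : Val → Val
    end (nat n)    = nat n
    end (pair _ v) = end v

    roundTime : ℕ → ℕ
    roundTime x = suc ((2 + x) ^ degree guard-≼) + (2 + x) ^ degree (time-≼ body)

    Halts : Val → Val → Val → Val → ℕ → Set
    Halts e xs a k B =
      ∃[ t ] ⟨ loop , ⟦ pair e (pair xs a) , k ⟧ ⟩⇓ ⟦ pair e (pair (end xs) (foldVal step e xs a)) , k ⟧ [ t ]
             × t ≤ suc (len xs) * roundTime (2 + B + ‖ k ‖)

    -- The remaining list shrinks and the potential does not grow, so the same `B` serves in every
    -- round. All states then have size at most `2 + B + ‖ k ‖`, the 2 paying for the two `pair`
    -- nodes.
    loop-runs : ∀ e xs a k B → ‖ e ‖ + (‖ xs ‖ + potential e xs a) ≤ B → Halts e xs a k B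
    loop-runs e xs a k B inv = rounds xs refl
      where
      open ≤-Reasoning
      state : State
      state = pair e (pair xs a) , k

      size≤ : ∣ state ∣ₛ ≤ 2 + B + ‖ k ‖
      size≤ = +-monoˡ-≤ ‖ k ‖ (s≤s (begin
        ‖ e ‖ + suc (‖ xs ‖ + ‖ a ‖)  ≡⟨ +-suc ‖ e ‖ _ ⟩
        suc (‖ e ‖ + (‖ xs ‖ + ‖ a ‖)) ≤⟨ s≤s (+-monoʳ-≤ ‖ e ‖ (+-monoʳ-≤ ‖ xs ‖ (acc≤ e xs a))) ⟩
        suc (‖ e ‖ + (‖ xs ‖ + potential e xs a)) ≤⟨ s≤s inv ⟩
        suc B ∎))

      guard≤ : cost guard ⟦ state ⟧ ≤ (2 + (2 + B + ‖ k ‖)) ^ degree guard-≼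
      guard≤ = ≤-trans (bound guard-≼ state) (^-monoˡ-≤ (degree guard-≼) (+-monoʳ-≤ 2 size≤))

      body≤ : time body state ≤ (2 + (2 + B + ‖ k ‖)) ^ degree (time-≼ body)
      body≤ = ≤-trans (bound (time-≼ body) state) (^-monoˡ-≤ (degree (time-≼ body)) (+-monoʳ-≤ 2 size≤))

      R : ℕ
      R = roundTime (2 + B + ‖ k ‖)

      -- The list is matched through an equation, so that `state` and its bounds, which mention
      -- `xs`, stay available in both cases.
      rounds : ∀ ys → xs ≡ ys → Halts e ys a k B
      rounds (nat n) refl = suc (cost guard ⟦ state ⟧) , ⇓-stop refl ,
        ≤-trans (s≤s guard≤) (≤-trans (m≤m+n _ _) (m≤m+n R 0))
      rounds (pair y ys) refl =
        let a′ = step (pair e (pair y a))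
            t , run , t≤ = loop-runs e ys a′ k B (begin
              ‖ e ‖ + (‖ ys ‖ + potential e ys a′)
                ≤⟨ +-monoʳ-≤ ‖ e ‖ (+-mono-≤ (‖sndVal‖ (pair y ys)) (decreasing e y ys a)) ⟩
              ‖ e ‖ + (‖ pair y ys ‖ + potential e (pair y ys) a) ≤⟨ inv ⟩
              B ∎)
        in suc (cost guard ⟦ state ⟧) + (time body state + t)
         , ⇓-loop (λ ()) (runs body state) run
         , (begin
             suc (cost guard ⟦ state ⟧) + (time body state + t)
               ≡⟨ +-assoc (suc (cost guard ⟦ state ⟧)) _ t ⟨
             suc (cost guard ⟦ state ⟧) + time body state + t
               ≤⟨ +-mono-≤ (+-mono-≤ (s≤s guard≤) body≤) t≤ ⟩
             R + suc (len ys) * R ∎)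

    budget : Val → ℕ
    budget w = ‖ π₁ w ‖ + (‖ π₂ w ‖ + potential (π₁ w) (π₂ w) (π₃ w))

    run : ∀ ((v , k) : State) → Halts (π₁ v) (π₂ v) (π₃ v) k (budget v)
    run (v , k) = loop-runs (π₁ v) (π₂ v) (π₃ v) k (budget v) ≤-refl

    onFirst : ∀ {b} → b ≼ ‖_‖ → (b ∘ proj₁) ≼ ∣_∣ₛ
    onFirst b≼ = ≼-∘ proj₁ b≼ (≼-mono (λ (v , k) → m≤m+n ‖ v ‖ ‖ k ‖) ≼-self)

    π₁-≼ : (‖_‖ ∘ π₁) ≼ ‖_‖
    π₁-≼ = ≼-mono ‖fstVal‖ ≼-self

    π₂-≼ : (‖_‖ ∘ π₂) ≼ ‖_‖
    π₂-≼ = ≼-mono (λ w → ≤-trans (‖fstVal‖ (sndVal w)) (‖sndVal‖ w)) ≼-self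

    iterated : Realizable λ (v , k) → pair (π₁ v) (pair (end (π₂ v)) (foldVal step (π₁ v) (π₂ v) (π₃ v))) , k
    iterated = record
      { command = command prepare ⨾ loop
      ; time    = λ s → time prepare s + proj₁ (run s)
      ; runs    = λ s → ⇓-seq (runs prepare s) (proj₁ (proj₂ (run s)))
      ; time-≼  = ≼-+ (time-≼ prepare) (≼-mono (λ s → proj₂ (proj₂ (run s)))
          (≼-* (≼-+ (≼-const 1) (onFirst (≼-mono (λ w → len≤‖ π₂ w ‖) π₂-≼)))
               (≼-+ (≼-+ (≼-const 1) (≼-^ (degree guard-≼) extent)) (≼-^ (degree (time-≼ body)) extent))))
      }
      where
      extent : (λ s → 2 + (2 + budget (proj₁ s) + ‖ proj₂ s ‖)) ≼ ∣_∣ₛ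
      extent = ≼-+ (≼-const 2) (≼-+ (≼-+ (≼-const 2) (onFirst (≼-+ π₁-≼ (≼-+ π₂-≼ potential-≼))))
                                    (≼-mono (λ (v , k) → m≤n+m ‖ k ‖ ‖ v ‖) ≼-self))

  unloaded : Realizable (λ s → sndVal (sndVal (proj₁ s)) , proj₂ s) → PolyTime λ w → foldVal step (π₁ w) (π₂ w) (π₃ w)
  unloaded = iterated ▸_

abstract
  foldₚ : ∀ {step} → PolyTime step → Potential step → PolyTime λ w → foldVal step (π₁ w) (π₂ w) (π₃ w)
  foldₚ stepₚ pot =
    Loop.unloaded pot (roundₚ stepₚ) (expr (cons (fst arg) (cons (fst (snd arg)) (snd (snd arg))))) (cost-≼ guard)
                  (val≔ (snd (snd (var zero))))

module _ {step : Val → Val} {gain : Val → ℕ}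
         (step≤ : ∀ e x a → ‖ step (pair e (pair x a)) ‖ ≤ ‖ a ‖ + gain (pair e x))
         (gain-≼ : gain ≼ ‖_‖) where

  private
    gains : Val → Val → ℕ
    gains e (nat _)     = 0
    gains e (pair x xs) = gain (pair e x) + gains e xs

    -- The bound `n` stays fixed while the list shrinks, giving all entries the same power `P`. The
    -- 3 is the 2 of `_≼_` plus one for the node of `pair e x`.
    gains≤ : ∀ e xs n → ‖ xs ‖ ≤ n → gains e xs ≤ ‖ xs ‖ * (3 + (‖ e ‖ + n)) ^ _≼_.degree gain-≼
    gains≤ e (nat _)     n _ = z≤n
    gains≤ e (pair x xs) n p = begin
      gain (pair e x) + gains e xs ≤⟨ +-mono-≤ gain≤ (gains≤ e xs n (≤-trans (‖sndVal‖ (pair x xs)) p)) ⟩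
      suc ‖ xs ‖ * P               ≤⟨ *-monoˡ-≤ P (s≤s (m≤n+m ‖ xs ‖ ‖ x ‖)) ⟩
      ‖ pair x xs ‖ * P            ∎
      where
      open ≤-Reasoning
      d = _≼_.degree gain-≼
      P = (3 + (‖ e ‖ + n)) ^ d
      gain≤ : gain (pair e x) ≤ P
      gain≤ = ≤-trans (_≼_.bound gain-≼ (pair e x))
        (^-monoˡ-≤ d (+-monoʳ-≤ 3 (+-monoʳ-≤ ‖ e ‖ (≤-trans (‖fstVal‖ (pair x xs)) p))))

  -- A gain depends on the entry but not on the accumulator, so gains add up instead of compounding.
  -- The potential sets aside the gains of all remaining entries.
  additive : Potential step
  additive = record
    { potential  = λ e xs a → ‖ a ‖ + gains e xs
    ; acc≤       = λ e xs a → m≤m+n ‖ a ‖ _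
    ; decreasing = λ e x xs a →
        ≤-trans (+-monoˡ-≤ (gains e xs) (step≤ e x a)) (≤-reflexive (+-assoc ‖ a ‖ _ _))
    ; potential-≼ = ≼-+ (≼-mono π₃≤ ≼-self)
        (≼-mono (λ w → gains≤ (π₁ w) (π₂ w) ‖ w ‖ (π₂≤ w))
          (≼-* (≼-mono π₂≤ ≼-self)
               (≼-^ (_≼_.degree gain-≼) (≼-+ (≼-const 3) (≼-+ (≼-mono ‖fstVal‖ ≼-self) ≼-self)))))
    }
    where
    π₂≤ : ∀ w → ‖ π₂ w ‖ ≤ ‖ w ‖
    π₂≤ w = ≤-trans (‖fstVal‖ (sndVal w)) (‖sndVal‖ w)
    π₃≤ : ∀ w → ‖ π₃ w ‖ ≤ ‖ w ‖
    π₃≤ w = ≤-trans (‖sndVal‖ (sndVal w)) (‖sndVal‖ w)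

push : Val → Val
push w = pair (π₂ w) (π₃ w)

pushₚ : PolyTime push
pushₚ = expr (cons (fst (snd arg)) (snd (snd arg)))

push-potential : Potential push
push-potential = additive {gain = suc ∘ ‖_‖} (λ e x a → begin
  suc (‖ x ‖ + ‖ a ‖)                ≡⟨ cong suc (+-comm ‖ x ‖ ‖ a ‖) ⟩
  suc (‖ a ‖ + ‖ x ‖)                ≡⟨ +-suc ‖ a ‖ ‖ x ‖ ⟨
  ‖ a ‖ + suc ‖ x ‖                  ≤⟨ +-monoʳ-≤ ‖ a ‖ (s≤s (‖sndVal‖ (pair e x))) ⟩
  ‖ a ‖ + suc ‖ pair e x ‖           ∎)
  (≼-+ (≼-const 1) ≼-self)
  where open ≤-Reasoning

‖foldVal-push‖ : ∀ e xs a → ‖ foldVal push e xs a ‖ ≤ ‖ a ‖ + ‖ xs ‖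
‖foldVal-push‖ e (nat n)     a = m≤m+n ‖ a ‖ _
‖foldVal-push‖ e (pair x xs) a = begin
  ‖ foldVal push e xs (pair x a) ‖  ≤⟨ ‖foldVal-push‖ e xs (pair x a) ⟩
  suc (‖ x ‖ + ‖ a ‖) + ‖ xs ‖      ≡⟨ solve 3 (λ x a s → con 1 :+ (x :+ a) :+ s := a :+ (con 1 :+ (x :+ s))) refl (‖ x ‖) (‖ a ‖) (‖ xs ‖) ⟩
  ‖ a ‖ + suc (‖ x ‖ + ‖ xs ‖)      ∎
  where open ≤-Reasoning

reverseVal : Val → Val
reverseVal v = foldVal push (nat 0) v (nat 0)

-- The loop consumes lists from the front, so a right fold is run as a left fold over the reversed
-- list.
foldrVal : (Val → Val) → Val → Val → Val → Val
foldrVal step e xs a = foldVal step e (reverseVal xs) a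

‖foldrVal-push‖ : ∀ e xs a → ‖ foldrVal push e xs a ‖ ≤ ‖ a ‖ + suc ‖ xs ‖
‖foldrVal-push‖ e xs a =
  ≤-trans (‖foldVal-push‖ e (reverseVal xs) a) (+-monoʳ-≤ ‖ a ‖ (‖foldVal-push‖ (nat 0) xs (nat 0)))

abstract
  foldrₚ : ∀ {step l i} → PolyTime step → Potential step → PolyTime l → PolyTime i →
           PolyTime λ v → foldrVal step v (l v) (i v)
  foldrₚ stepₚ pot lₚ iₚ =
    foldₚ stepₚ pot ∘ₚ
    (expr arg ,ₚ ((foldₚ pushₚ push-potential ∘ₚ (expr (const 0) ,ₚ lₚ ,ₚ expr (const 0))) ,ₚ iₚ))

length : Val → Val
length = nat ∘ len

abstract
  lengthₚ : PolyTime length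
  lengthₚ = PolyTime-cong (λ v → trans (counts v 0) (cong nat (+-identityʳ (len v))))
    (foldₚ (expr (add (const 1) (snd (snd arg))))
           (additive {gain = λ _ → 2} (λ _ _ a → gain a) (≼-const 2))
     ∘ₚ expr (cons (const 0) (cons arg (const 0))))
    where
    step : Val → Val
    step = ⟨ add (const 1) (snd (snd arg)) ⟩

    gain : ∀ a → ‖ nat (1 + toNat a) ‖ ≤ ‖ a ‖ + 2
    gain a = begin
      ‖ nat (1 + toNat a) ‖      ≤⟨ ‖nat-+‖ 1 (toNat a) ⟩
      2 + ‖ nat (toNat a) ‖      ≤⟨ +-monoʳ-≤ 2 (‖toNat‖ a) ⟩
      2 + ‖ a ‖                  ≡⟨ +-comm 2 ‖ a ‖ ⟩
      ‖ a ‖ + 2                  ∎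
      where open ≤-Reasoning

    counts : ∀ v c → foldVal step (nat 0) v (nat c) ≡ nat (len v + c)
    counts (nat _)    c = refl
    counts (pair u v) c = trans (counts v (suc c)) (cong nat (+-suc (len v) c))


-- Functions on encoded families

foldVal-list : ∀ step e xs a →
  foldVal step e (encodeList xs) a ≡ foldl (λ a x → step (pair e (pair x a))) a xs
foldVal-list step e []       a = refl
foldVal-list step e (x ∷ xs) a = foldVal-list step e xs _

reverseVal-list : ∀ xs → reverseVal (encodeList xs) ≡ encodeList (reverse xs)
reverseVal-list xs = begin
  foldVal push (nat 0) (encodeList xs) (nat 0)  ≡⟨ foldVal-list push (nat 0) xs (nat 0) ⟩
  foldl (flip pair) (nat 0) xs                  ≡⟨ reverse-foldr pair (nat 0) xs ⟨
  foldr pair (nat 0) (reverse xs)               ≡⟨ foldr-pair (reverse xs) ⟩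
  encodeList (reverse xs)                       ∎
  where
  open ≡-Reasoning
  foldr-pair : ∀ xs → foldr pair (nat 0) xs ≡ encodeList xs
  foldr-pair []       = refl
  foldr-pair (x ∷ xs) = cong (pair x) (foldr-pair xs)

foldrVal-list : ∀ step e xs a →
  foldrVal step e (encodeList xs) a ≡ foldr (λ x a → step (pair e (pair x a))) a xs
foldrVal-list step e xs a = begin
  foldVal step e (reverseVal (encodeList xs)) a  ≡⟨ cong (λ ys → foldVal step e ys a) (reverseVal-list xs) ⟩
  foldVal step e (encodeList (reverse xs)) a     ≡⟨ foldVal-list step e (reverse xs) a ⟩
  foldl _ a (reverse xs)                         ≡⟨ reverse-foldl _ a xs ⟩
  foldr _ a xs                                   ∎
  where open ≡-Reasoning

table : ∀ {n} → (Fin n → Val) → Val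
table r = encodeList (tabulate r)

len-table : ∀ {n} (r : Fin n → Val) → len (table r) ≡ n
len-table {zero}  r = refl
len-table {suc n} r = cong suc (len-table (r ∘ suc))

-- Each entry is passed to `f` together with the whole input `v`. This lets loops nest, as an inner
-- loop still sees the entries of the outer ones.
each : (Val → Val) → (Val → Val) → Val → Val
each f l v = foldrVal (λ w → pair (f (pair (π₁ w) (π₂ w))) (π₃ w)) v (l v) (nat 0)

abstract
  eachₚ : ∀ {f l} → PolyTime f → PolyTime l → PolyTime (each f l)
  eachₚ {f} fₚ lₚ = foldrₚ
    (fₚ ∘ₚ expr (cons (fst arg) (fst (snd arg))) ,ₚ expr (snd (snd arg)))
    (additive {gain = λ v → suc ‖ f v ‖} (λ e x a → ≤-reflexive (trans
       (cong suc (+-comm ‖ f (pair e x) ‖ ‖ a ‖)) (sym (+-suc ‖ a ‖ _))))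
      (≼-+ (≼-const 1) (‖ fₚ ‖-≼)))
    lₚ (expr (const 0))

each-table : ∀ f l v {n} {r h : Fin n → Val} → l v ≡ table r → (∀ i → f (pair v (r i)) ≡ h i) →
             each f l v ≡ table h
each-table f l v {r = r} {h} l≡ f≡ rewrite l≡ = trans (foldrVal-list _ v (tabulate r) (nat 0)) (go r h f≡)
  where
  go : ∀ {n} (r h : Fin n → Val) → (∀ i → f (pair v (r i)) ≡ h i) →
       foldr (λ x a → pair (f (pair v x)) a) (nat 0) (tabulate r) ≡ table h
  go {zero}  r h f≡ = refl
  go {suc n} r h f≡ = cong₂ pair (f≡ zero) (go (r ∘ suc) (h ∘ suc) (f≡ ∘ suc))

append : (Val → Val) → (Val → Val) → Val → Val
append f g v = foldrVal push v (f v) (g v)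

abstract
  appendₚ : ∀ {f g} → PolyTime f → PolyTime g → PolyTime (append f g)
  appendₚ = foldrₚ pushₚ push-potential

append-tables : ∀ {m n} (a : Fin m → Val) (b : Fin n → Val) (h : Fin (m + n) → Val) →
  (∀ i → h (i ↑ˡ n) ≡ a i) → (∀ j → h (m ↑ʳ j) ≡ b j) →
  foldr pair (table b) (tabulate a) ≡ table h
append-tables {zero}  a b h h≡a h≡b = cong encodeList (tabulate-cong (sym ∘ h≡b))
append-tables {suc m} a b h h≡a h≡b =
  cong₂ pair (sym (h≡a zero)) (append-tables (a ∘ suc) b (h ∘ suc) (h≡a ∘ suc) h≡b)

append-table : ∀ f g v {m n} {a : Fin m → Val} {b : Fin n → Val} {h : Fin (m + n) → Val} →
  f v ≡ table a → g v ≡ table b →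
  (∀ i → h (i ↑ˡ n) ≡ a i) → (∀ j → h (m ↑ʳ j) ≡ b j) →
  append f g v ≡ table h
append-table f g v {a = a} {b} {h} f≡ g≡ h≡a h≡b rewrite f≡ | g≡ =
  trans (foldrVal-list push v (tabulate a) (table b)) (append-tables a b h h≡a h≡b)

concatEach : (Val → Val) → (Val → Val) → Val → Val
concatEach f l v = foldrVal (append (λ w → f (pair (π₁ w) (π₂ w))) π₃) v (l v) (nat 0)

abstract
  concatEachₚ : ∀ {f l} → PolyTime f → PolyTime l → PolyTime (concatEach f l)
  concatEachₚ {f} fₚ lₚ = foldrₚ
    (appendₚ (fₚ ∘ₚ expr (cons (fst arg) (fst (snd arg)))) (expr (snd (snd arg))))
    (additive {gain = λ v → suc ‖ f v ‖} (λ e x a → ‖foldrVal-push‖ (pair e (pair x a)) (f (pair e x)) a)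
      (≼-+ (≼-const 1) (‖ fₚ ‖-≼)))
    lₚ (expr (const 0))

-- `combine` numbers pairs row by row, which is the order in which the equally long lists are
-- concatenated.
concatEach-table : ∀ f l v {m n} {r : Fin m → Val} {h : Fin m → Fin n → Val} {g : Fin (m * n) → Val} →
  l v ≡ table r → (∀ i → f (pair v (r i)) ≡ table (h i)) →
  (∀ i j → g (combine i j) ≡ h i j) →
  concatEach f l v ≡ table g
concatEach-table f l v {n = n} {r} {h} {g} l≡ f≡ g≡ rewrite l≡ =
  trans (foldrVal-list _ v (tabulate r) (nat 0)) (go r h g f≡ g≡)
  where
  go : ∀ {m} (r : Fin m → Val) (h : Fin m → Fin n → Val) (g : Fin (m * n) → Val) →
       (∀ i → f (pair v (r i)) ≡ table (h i)) → (∀ i j → g (combine i j) ≡ h i j) →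
       foldr (λ x a → append (λ w → f (pair (π₁ w) (π₂ w))) π₃ (pair v (pair x a))) (nat 0) (tabulate r) ≡ table g
  go {zero}  r h g f≡ g≡ = refl
  go {suc m} r h g f≡ g≡ = append-table (λ w → f (pair (π₁ w) (π₂ w))) π₃ (pair v (pair (r zero) _))
    (f≡ zero) (go (r ∘ suc) (h ∘ suc) (g ∘ (n ↑ʳ_)) (f≡ ∘ suc) (g≡ ∘ suc)) (g≡ zero) (λ _ → refl)

label : Val → Val
label w = pair (pair (length (π₃ w)) (π₂ w)) (π₃ w)

-- Entries are numbered from the end of the list, hence the use of opposite below.
enumerate : (Val → Val) → Val → Val
enumerate l v = foldrVal label v (l v) (nat 0)

-- `additive` does not apply, since the label depends on the length of the accumulator. That length
-- plus the length of the remaining list is invariant, so it bounds every label still to come and is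
-- reserved once per remaining entry.
label-potential : Potential label
label-potential = record
  { potential  = λ e xs a → ‖ a ‖ + (len xs * (4 + (len a + len xs)) + ‖ xs ‖)
  ; acc≤       = λ e xs a → m≤m+n ‖ a ‖ _
  ; decreasing = λ e x xs a → begin
      suc (suc (‖ length a ‖ + ‖ x ‖) + ‖ a ‖) + (len xs * (4 + (suc (len a) + len xs)) + ‖ xs ‖)
        ≤⟨ +-monoˡ-≤ _ (s≤s (+-monoˡ-≤ ‖ a ‖ (s≤s (+-monoˡ-≤ ‖ x ‖ (‖nat‖≤suc (len a)))))) ⟩
      suc (suc (suc (len a) + ‖ x ‖) + ‖ a ‖) + (len xs * (4 + (suc (len a) + len xs)) + ‖ xs ‖)
        ≤⟨ m≤m+n _ (3 + len xs) ⟩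
      suc (suc (suc (len a) + ‖ x ‖) + ‖ a ‖) + (len xs * (4 + (suc (len a) + len xs)) + ‖ xs ‖) + (3 + len xs)
        ≡⟨ solve 5 (λ k x a l s →
             con 1 :+ (con 1 :+ (con 1 :+ k :+ x) :+ a) :+ (l :* (con 4 :+ (con 1 :+ k :+ l)) :+ s) :+ (con 3 :+ l)
             := a :+ ((con 1 :+ l) :* (con 4 :+ (k :+ (con 1 :+ l))) :+ (con 1 :+ (x :+ s))))
             refl (len a) (‖ x ‖) (‖ a ‖) (len xs) (‖ xs ‖) ⟩
      ‖ a ‖ + (suc (len xs) * (4 + (len a + suc (len xs))) + suc (‖ x ‖ + ‖ xs ‖)) ∎
  ; potential-≼ = ≼-+ (≼-mono π₃≤ ≼-self)
      (≼-+ (≼-* len-π₂ (≼-+ (≼-const 4) (≼-+ (≼-mono (λ w → ≤-trans len≤‖ π₃ w ‖ (π₃≤ w)) ≼-self) len-π₂)))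
           (≼-mono π₂≤ ≼-self))
  }
  where
  open ≤-Reasoning
  π₂≤ : ∀ w → ‖ π₂ w ‖ ≤ ‖ w ‖
  π₂≤ w = ≤-trans (‖fstVal‖ (sndVal w)) (‖sndVal‖ w)
  π₃≤ : ∀ w → ‖ π₃ w ‖ ≤ ‖ w ‖
  π₃≤ w = ≤-trans (‖sndVal‖ (sndVal w)) (‖sndVal‖ w)
  len-π₂ : (λ w → len (π₂ w)) ≼ ‖_‖
  len-π₂ = ≼-mono (λ w → ≤-trans len≤‖ π₂ w ‖ (π₂≤ w)) ≼-self

abstract
  enumerateₚ : ∀ {l} → PolyTime l → PolyTime (enumerate l)
  enumerateₚ lₚ = foldrₚ
    ((lengthₚ ∘ₚ expr (snd (snd arg)) ,ₚ expr (fst (snd arg))) ,ₚ expr (snd (snd arg)))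
    label-potential lₚ (expr (const 0))

enumerate-table : ∀ l v {n} {r : Fin n → Val} → l v ≡ table r →
                  enumerate l v ≡ table (λ i → pair (nat (toℕ (opposite i))) (r i))
enumerate-table l v {r = r} l≡ rewrite l≡ = trans (foldrVal-list label v (tabulate r) (nat 0)) (go r)
  where
  go : ∀ {n} (r : Fin n → Val) →
       foldr (λ x a → label (pair v (pair x a))) (nat 0) (tabulate r) ≡
       table (λ i → pair (nat (toℕ (opposite i))) (r i))
  go {zero}  r = refl
  go {suc n} r rewrite go (r ∘ suc) = cong₂ pair
    (cong (λ m → pair (nat m) (r zero)) (trans (len-table _) (sym (toℕ-fromℕ n))))
    (cong encodeList (tabulate-cong λ i → cong (λ m → pair (nat m) (r (suc i))) (sym (toℕ-inject₁ (opposite i)))))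

-- Intersection graphs of squares

-- Given directly in lowest terms, so that numerator and denominator compute; `itemE-correct` and
-- `adjacencyE-correct` rely on this.
natℚ : ℕ → ℚ
natℚ m = mkℚ (ℤ.+ m) 0 (Coprime.sym (Coprime.1-coprimeTo m))

natℚ-mono-≤ : ∀ {m n} → m ≤ n → natℚ m ℚ.≤ natℚ n
natℚ-mono-≤ {m} {n} m≤n =
  *≤* (subst₂ ℤ._≤_ (sym (ℤ.*-identityʳ (ℤ.+ m))) (sym (ℤ.*-identityʳ (ℤ.+ n))) (ℤ.+≤+ m≤n))

natℚ-cancel-≤ : ∀ {m n} → natℚ m ℚ.≤ natℚ n → m ≤ n
natℚ-cancel-≤ {m} {n} (*≤* p) =
  ℤ.drop‿+≤+ (subst₂ ℤ._≤_ (ℤ.*-identityʳ (ℤ.+ m)) (ℤ.*-identityʳ (ℤ.+ n)) p)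

-- Addition on `ℚ` renormalises its result, so the identity is checked on unnormalised fractions.
natℚ-+ : ∀ m n → natℚ (m + n) ≡ natℚ m ℚ.+ natℚ n
natℚ-+ m n = ℚ.toℚᵘ-injective (ℚᵘ.≃-trans
  (*≡* (cong (ℤ._* (ℤ.+ 1)) (sym (cong₂ ℤ._+_ (ℤ.*-identityʳ (ℤ.+ m)) (ℤ.*-identityʳ (ℤ.+ n))))))
  (ℚᵘ.≃-sym (ℚ.toℚᵘ-homo-+ (natℚ m) (natℚ n))))

interval : ℕ → ℕ → Interval
interval x ℓ = record { lo = natℚ x ; hi = natℚ (x + ℓ) ; lo≤hi = natℚ-mono-≤ (m≤m+n x ℓ) }

length-interval : ∀ x ℓ → Interval.length (interval x ℓ) ≡ natℚ ℓ
length-interval x ℓ = begin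
  natℚ (x + ℓ) ℚ.- natℚ x              ≡⟨ cong (ℚ._- natℚ x) (natℚ-+ x ℓ) ⟩
  natℚ x ℚ.+ natℚ ℓ ℚ.- natℚ x         ≡⟨ cong (ℚ._- natℚ x) (ℚ.+-comm (natℚ x) (natℚ ℓ)) ⟩
  natℚ ℓ ℚ.+ natℚ x ℚ.- natℚ x         ≡⟨ ℚ.+-assoc (natℚ ℓ) (natℚ x) (ℚ.- natℚ x) ⟩
  natℚ ℓ ℚ.+ (natℚ x ℚ.- natℚ x)       ≡⟨ cong (natℚ ℓ ℚ.+_) (ℚ.+-inverseʳ (natℚ x)) ⟩
  natℚ ℓ ℚ.+ ℚ.0ℚ                      ≡⟨ ℚ.+-identityʳ (natℚ ℓ) ⟩
  natℚ ℓ                               ∎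
  where open ≡-Reasoning

record Square : Set where
  constructor square
  field
    left bottom side : ℕ

open Square

-- The product of the two intervals of a balanced 2-track interval is a square.
twoTrack : Square → TwoTrackInterval
twoTrack Q zero       = interval (left Q) (side Q)
twoTrack Q (suc zero) = interval (bottom Q) (side Q)

balanced-twoTrack : ∀ Q → Balanced (twoTrack Q)
balanced-twoTrack (square x y ℓ) = trans (length-interval x ℓ) (sym (length-interval y ℓ))

Overlap : ℕ → ℕ → ℕ → ℕ → Set
Overlap x ℓ x′ ℓ′ = x ≤ x′ + ℓ′ × x′ ≤ x + ℓ

Touch : Square → Square → Set
Touch (square x y ℓ) (square x′ y′ ℓ′) = Overlap x ℓ x′ ℓ′ ⊎ Overlap y ℓ y′ ℓ′

touch⇔meet : ∀ Q Q′ → Touch Q Q′ ⇔ points (twoTrack Q) ≬ points (twoTrack Q′)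
touch⇔meet Q Q′ = mk⇔ meet touch
  where
  common : ∀ x ℓ x′ ℓ′ → Overlap x ℓ x′ ℓ′ → ∃[ q ]
    (natℚ x ℚ.≤ q × q ℚ.≤ natℚ (x + ℓ)) × (natℚ x′ ℚ.≤ q × q ℚ.≤ natℚ (x′ + ℓ′))
  -- The larger of the two left endpoints belongs to both intervals.
  common x ℓ x′ ℓ′ (p , q) = natℚ (x ⊔ x′)
    , (natℚ-mono-≤ (m≤m⊔n x x′) , natℚ-mono-≤ (⊔-lub (m≤m+n x ℓ) q))
    , (natℚ-mono-≤ (m≤n⊔m x x′) , natℚ-mono-≤ (⊔-lub p (m≤m+n x′ ℓ′)))

  meet : Touch Q Q′ → points (twoTrack Q) ≬ points (twoTrack Q′)
  meet (inj₁ o) = let q , p , p′ = common _ _ _ _ o in (zero , q) , p , p′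
  meet (inj₂ o) = let q , p , p′ = common _ _ _ _ o in (suc zero , q) , p , p′

  touch : points (twoTrack Q) ≬ points (twoTrack Q′) → Touch Q Q′
  touch ((zero , q) , (a , b) , (c , d)) =
    inj₁ (natℚ-cancel-≤ (ℚ.≤-trans a d) , natℚ-cancel-≤ (ℚ.≤-trans c b))
  touch ((suc zero , q) , (a , b) , (c , d)) =
    inj₂ (natℚ-cancel-≤ (ℚ.≤-trans a d) , natℚ-cancel-≤ (ℚ.≤-trans c b))

≤ᵇ≡true : ∀ m n → (m ≤ᵇ n) ≡ true ⇔ m ≤ n
≤ᵇ≡true m n = mk⇔ (≤ᵇ⇒≤ m n ∘ from Bool.T-≡) (to Bool.T-≡ ∘ ≤⇒≤ᵇ)

1≤bit : ∀ m n → 1 ≤ bit (m ≤ᵇ n) ⇔ m ≤ n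
1≤bit m n = ⇔.trans (lift (m ≤ᵇ n)) (≤ᵇ≡true m n)
  where
  lift : ∀ b → 1 ≤ bit b ⇔ b ≡ true
  lift true  = mk⇔ (λ _ → refl) (λ _ → s≤s z≤n)
  lift false = mk⇔ (λ ()) (λ ())

-- Conditions are computed as numbers, positive meaning true: products express conjunction and, in
-- `1≤+`, sums express disjunction. The expression language has arithmetic and comparison but no
-- connectives.
1≤* : ∀ a b → 1 ≤ a * b ⇔ (1 ≤ a × 1 ≤ b)
1≤* zero    b       = mk⇔ (λ ()) (λ { (() , _) })
1≤* (suc a) zero    = mk⇔ (λ p → contradiction (subst (1 ≤_) (*-zeroʳ a) p) λ ()) (λ { (_ , ()) })
1≤* (suc a) (suc b) = mk⇔ (λ _ → s≤s z≤n , s≤s z≤n) (λ _ → s≤s z≤n)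

1≤+ : ∀ a b → 1 ≤ a + b ⇔ (1 ≤ a ⊎ 1 ≤ b)
1≤+ zero    b = mk⇔ inj₂ λ { (inj₁ ()) ; (inj₂ p) → p }
1≤+ (suc a) b = mk⇔ (λ _ → inj₁ (s≤s z≤n)) (λ _ → s≤s z≤n)

apart : ℕ → ℕ → ℕ
apart i j = bit (1 + i ≤ᵇ j) + bit (1 + j ≤ᵇ i)

-- Right endpoints are used in place of lengths because `adjacencyE` reads endpoints off the encoded
-- intervals.
overlaps : ℕ → ℕ → ℕ → ℕ → ℕ
overlaps x r x′ r′ = bit (x ≤ᵇ r′) * bit (x′ ≤ᵇ r)

touch : Square → Square → ℕ
touch (square x y ℓ) (square x′ y′ ℓ′) =
  overlaps x (x + ℓ) x′ (x′ + ℓ′) + overlaps y (y + ℓ) y′ (y′ + ℓ′)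

1≤apart : ∀ i j → 1 ≤ apart i j ⇔ i ≢ j
1≤apart i j = ⇔.trans (1≤+ _ _) (mk⇔
  [ (λ p → <⇒≢ (to (1≤bit (suc i) j) p)) , (λ p → >⇒≢ (to (1≤bit (suc j) i) p)) ]′
  λ i≢j → Sum.map (from (1≤bit (suc i) j)) (from (1≤bit (suc j) i)) (≢⇒<∨> i≢j))
  where
  ≢⇒<∨> : i ≢ j → i < j ⊎ j < i
  ≢⇒<∨> i≢j with <-cmp i j
  ... | tri< p _ _ = inj₁ p
  ... | tri≈ _ p _ = contradiction p i≢j
  ... | tri> _ _ p = inj₂ p

1≤overlaps : ∀ x ℓ x′ ℓ′ → 1 ≤ overlaps x (x + ℓ) x′ (x′ + ℓ′) ⇔ Overlap x ℓ x′ ℓ′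
1≤overlaps x ℓ x′ ℓ′ = ⇔.trans (1≤* _ _) (mk⇔
  (λ (p , q) → to (1≤bit x (x′ + ℓ′)) p , to (1≤bit x′ (x + ℓ)) q)
  (λ (p , q) → from (1≤bit x (x′ + ℓ′)) p , from (1≤bit x′ (x + ℓ)) q))

1≤touch : ∀ Q Q′ → 1 ≤ touch Q Q′ ⇔ Touch Q Q′
1≤touch (square x y ℓ) (square x′ y′ ℓ′) = ⇔.trans (1≤+ _ _) (mk⇔
  (Sum.map (to (1≤overlaps x ℓ x′ ℓ′)) (to (1≤overlaps y ℓ y′ ℓ′)))
  (Sum.map (from (1≤overlaps x ℓ x′ ℓ′)) (from (1≤overlaps y ℓ y′ ℓ′))))

adjacency : ℕ → Square → ℕ → Square → ℕ
adjacency i Q j Q′ = apart i j * touch Q Q′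

adjacency-comm : ∀ i Q j Q′ → adjacency i Q j Q′ ≡ adjacency j Q′ i Q
adjacency-comm i Q j Q′ = cong₂ _*_
  (+-comm (bit (1 + i ≤ᵇ j)) (bit (1 + j ≤ᵇ i)))
  (cong₂ _+_ (*-comm (bit (left Q ≤ᵇ left Q′ + side Q′)) _) (*-comm (bit (bottom Q ≤ᵇ bottom Q′ + side Q′)) _))

-- The number that `enumerate` attaches to position `i`.
rank : ∀ {n} → Fin n → ℕ
rank i = toℕ (opposite i)

rank-injective : ∀ {n} {i j : Fin n} → rank i ≡ rank j → i ≡ j
rank-injective {i = i} {j} eq = trans (sym (opposite-involutive i))
  (trans (cong opposite (toℕ-injective eq)) (opposite-involutive j))

module _ {N : ℕ} (Q : Fin N → Square) where

  adjacent⇔ : ∀ i j → (1 ≤ᵇ adjacency (rank i) (Q i) (rank j) (Q j)) ≡ true ⇔ (i ≢ j × Touch (Q i) (Q j))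
  adjacent⇔ i j = ⇔.trans (≤ᵇ≡true 1 _) (⇔.trans (1≤* (apart (rank i) (rank j)) _) (mk⇔
    (λ (p , q) → to (1≤apart _ _) p ∘ cong rank , to (1≤touch (Q i) (Q j)) q)
    (λ (p , q) → from (1≤apart _ _) (p ∘ rank-injective) , from (1≤touch (Q i) (Q j)) q)))

  squareGraph : Graph N
  squareGraph = record
    { adj    = λ i j → 1 ≤ᵇ adjacency (rank i) (Q i) (rank j) (Q j)
    ; sym    = λ i j → cong (1 ≤ᵇ_) (adjacency-comm (rank i) (Q i) (rank j) (Q j))
    ; irrefl = irreflexive
    }
    where
    irreflexive : ∀ i → (1 ≤ᵇ adjacency (rank i) (Q i) (rank i) (Q i)) ≡ false
    irreflexive i with 1 ≤ᵇ adjacency (rank i) (Q i) (rank i) (Q i) in eq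
    ... | false = refl
    ... | true  = contradiction refl (proj₁ (to (adjacent⇔ i i) eq))

  squareRepresentation : BalancedRepresentation squareGraph
  squareRepresentation = record
    { family     = twoTrack ∘ Q
    ; balanced   = balanced-twoTrack ∘ Q
    ; represents = λ i j i≢j → ⇔.trans (adjacent⇔ i j)
        (mk⇔ (to (touch⇔meet (Q i) (Q j)) ∘ proj₂) (λ m → i≢j , from (touch⇔meet (Q i) (Q j)) m))
    }

-- The reduction

-- a and b are the numbers of the row and the column, and c is the code of the item:
-- 2 for the vertex spanning the cell of the row, otherwise the adjacency bit of the
-- row and the column, or 0 for padding.  A diagonal entry counts as an arc as well.
selected : ℕ → ℕ → ℕ → ℕ
selected a b c = bit (1 ≤ᵇ bit (c ≤ᵇ 1) * bit (1 ≤ᵇ c) + bit (a ≤ᵇ b) * bit (b ≤ᵇ a))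

-- `selected` is a switch. At 0 the square starts at the first point of cell `a` on both tracks; at
-- 1 it starts at offset `1 + b` in cell `a` on the first track and at offset `1 + a` in cell `b` on
-- the second, so offset 0 is left to blockers and spanning vertices. Side `n` reaches the last of
-- the `n + 1` points of a cell.
itemSquare : ℕ → ℕ → ℕ → ℕ → Square
itemSquare n a b c = square
  (a * (n + 1) + selected a b c * (1 + b))
  ((1 ∸ selected a b c) * (a * (n + 1)) + selected a b c * (b * (n + 1) + (1 + a)))
  (n * bit (2 ≤ᵇ c))

natE : Expr 1 → Expr 1
natE e = cons (cons (const 0) e) (const 1)

intervalE : Expr 1 → Expr 1 → Expr 1
intervalE x ℓ = cons (natE x) (natE (add x ℓ))

itemE : Expr 1
itemE = cons (intervalE x ℓ) (intervalE y ℓ)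
  where
  n = fst (fst (fst (fst arg)))
  a = fst (snd (fst arg))
  b = fst (snd arg)
  c = snd (snd arg)
  s = leq (const 1) (add (mul (leq c (const 1)) (leq (const 1) c)) (mul (leq a b) (leq b a)))
  x = add (mul a (add n (const 1))) (mul s (add (const 1) b))
  y = add (mul (sub (const 1) s) (mul a (add n (const 1))))
          (mul s (add (mul b (add n (const 1))) (add (const 1) a)))
  ℓ = mul n (leq (const 2) c)

adjacencyE : Expr 1
adjacencyE = leq (const 1) (mul (add (leq (add (const 1) i) j) (leq (add (const 1) j) i))
                                (add (overlapsE (fst Q) (fst Q′)) (overlapsE (snd Q) (snd Q′))))
  where
  i  = fst (snd (fst arg))
  Q  = snd (snd (fst arg))
  j  = fst (snd arg)
  Q′ = snd (snd arg)
  numerator : Expr 1 → Expr 1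
  numerator q = snd (fst q)
  overlapsE : Expr 1 → Expr 1 → Expr 1
  overlapsE I J = mul (leq (numerator (fst I)) (numerator (snd J)))
                      (leq (numerator (fst J)) (numerator (snd I)))

-- `itemE` repeats `itemSquare` operation by operation, so evaluation alone proves the equation.
itemE-correct : ∀ n rest blanks row a b c →
  ⟨ itemE ⟩ (pair (pair (pair (pair (nat n) rest) blanks) (pair (nat a) row)) (pair (nat b) (nat c)))
  ≡ encodeTwoTrack (twoTrack (itemSquare n a b c))
itemE-correct n rest blanks row a b c = refl

adjacencyE-correct : ∀ v i Q j Q′ →
  ⟨ adjacencyE ⟩ (pair (pair v (pair (nat i) (encodeTwoTrack (twoTrack Q)))) (pair (nat j) (encodeTwoTrack (twoTrack Q′))))
  ≡ nat (bit (1 ≤ᵇ adjacency i Q j Q′))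
adjacencyE-correct v i Q j Q′ = refl

-- Only the length `2 + n` of this list matters: a nested iteration over it produces the
-- `(2 + n) * (2 + n)` padding codes that become blockers.
twoMoreE : Expr 1
twoMoreE = cons (const 0) (cons (const 0) (fst (snd arg)))

measured : Val → Val
measured v = pair (length (fstVal v)) v

zeros : Val → Val
zeros = concatEach (each ⟨ const 0 ⟩ (⟨ twoMoreE ⟩ ∘ fstVal)) ⟨ twoMoreE ⟩

context : Val → Val
context v = pair (⟨ cons (fst arg) (fst (snd arg)) ⟩ v) (zeros v)

-- The codes of one row: the spanning vertex first, then the padding, then the adjacency bits.
columns : Val → Val
columns = enumerate (λ v → pair (nat 2) (append ⟨ snd (fst arg) ⟩ ⟨ snd (snd arg) ⟩ v))

items : Val → Val
items = concatEach (each ⟨ itemE ⟩ columns) (enumerate ⟨ snd (fst arg) ⟩) ∘ context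

matrix : Val → Val
matrix = each (each ⟨ adjacencyE ⟩ ⟨ fst arg ⟩) ⟨ arg ⟩ ∘ enumerate items

parametersE : Expr 1
parametersE = cons k (mul k k)
  where
  k = sub (snd (snd arg)) (sub (snd (snd arg)) (add (fst arg) (const 1)))

reduction : Val → Val
reduction = (λ v → pair (pair (matrix v) (items v)) (⟨ parametersE ⟩ v)) ∘ measured

abstract
  reductionₚ : PolyTime reduction
  reductionₚ = ((matrixₚ ,ₚ itemsₚ) ,ₚ expr parametersE) ∘ₚ (lengthₚ ∘ₚ expr (fst arg) ,ₚ expr arg)
    where
    zerosₚ : PolyTime zeros
    zerosₚ = concatEachₚ (eachₚ (expr (const 0)) (expr twoMoreE ∘ₚ expr (fst arg))) (expr twoMoreE)

    columnsₚ : PolyTime columns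
    columnsₚ = enumerateₚ (expr (const 2) ,ₚ appendₚ (expr (snd (fst arg))) (expr (snd (snd arg))))

    itemsₚ : PolyTime items
    itemsₚ = concatEachₚ (eachₚ (expr itemE) columnsₚ) (enumerateₚ (expr (snd (fst arg))))
             ∘ₚ (expr (cons (fst arg) (fst (snd arg))) ,ₚ zerosₚ)

    matrixₚ : PolyTime matrix
    matrixₚ = eachₚ (eachₚ (expr adjacencyE) (expr (fst arg))) (expr arg) ∘ₚ enumerateₚ itemsₚ

-- The minimum of k and n + 1, through truncated subtraction.
cap : ℕ → ℕ → ℕ
cap n k = k ∸ (k ∸ (n + 1))

-- The constructed instance and the correctness of the program

module Construction {n : ℕ} (G : Graph n) where
  open Graph G using (adj)

  -- A vertex of `G` contributes one spanning vertex, `M` blockers and `n` possible arcs. `M`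
  -- exceeds `κ * κ + κ` for all `κ ≤ n + 1`; without the cap it would have to grow with `k`, which
  -- is given in binary.
  M W : ℕ
  M = (2 + n) * (2 + n)
  W = suc (M + n)

  code : Fin n → Fin W → ℕ
  code u zero    = 2
  code u (suc j) = [ (λ _ → 0) , (λ v → bit (adj u v)) ]′ (splitAt M j)

  cell : Fin n × Fin W → Square
  cell (u , j) = itemSquare n (rank u) (rank j) (code u j)

  squares : Fin (n * W) → Square
  squares = cell ∘ remQuot W

  H : Graph (n * W)
  H = squareGraph squares

  instanceFor : ℕ → SeparationInstance
  instanceFor k = record
    { graph          = H
    ; representation = squareRepresentation squares
    ; k              = cap n k
    ; l              = cap n k * cap n k
    }

  module Correct (k : Val) where
    row : Fin n → Fin n → Val
    row u v = nat (bit (adj u v))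

    rows : Fin n → Val
    rows = table ∘ row

    input : Val
    input = pair (nat n) (pair (table rows) k)

    blanks : Fin (2 + n) → Val
    blanks zero          = nat 0
    blanks (suc zero)    = nat 0
    blanks (suc (suc u)) = rows u

    zeros-correct : zeros input ≡ table {M} (λ _ → nat 0)
    zeros-correct = concatEach-table (each ⟨ const 0 ⟩ (⟨ twoMoreE ⟩ ∘ fstVal)) ⟨ twoMoreE ⟩ input
      {r = blanks} refl
      (λ i → each-table ⟨ const 0 ⟩ (⟨ twoMoreE ⟩ ∘ fstVal) (pair input (blanks i)) {r = blanks} refl (λ _ → refl))
      (λ _ _ → refl)

    ctx : Val
    ctx = pair (pair (nat n) (table rows)) (zeros input)

    column : Fin n → Fin W → Val
    column u j = nat (code u j)

    inRow : Fin n → Val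
    inRow u = pair ctx (pair (nat (rank u)) (rows u))

    columns-correct : ∀ u → columns (inRow u) ≡ table (λ j → pair (nat (rank j)) (column u j))
    columns-correct u = enumerate-table (λ v → pair (nat 2) (append ⟨ snd (fst arg) ⟩ ⟨ snd (snd arg) ⟩ v)) (inRow u)
      {r = column u}
      (cong (pair (nat 2)) (append-table ⟨ snd (fst arg) ⟩ ⟨ snd (snd arg) ⟩ (inRow u)
        {b = row u} {h = column u ∘ suc} zeros-correct refl
        (λ i → cong (nat ∘ [ (λ _ → 0) , (λ v → bit (adj u v)) ]′) (splitAt-↑ˡ M i n))
        (λ v → cong (nat ∘ [ (λ _ → 0) , (λ v → bit (adj u v)) ]′) (splitAt-↑ʳ M n v))))

    encoded : Fin (n * W) → Val
    encoded i = encodeTwoTrack (twoTrack (squares i))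

    items-correct : items input ≡ table encoded
    items-correct = concatEach-table (each ⟨ itemE ⟩ columns) (enumerate ⟨ snd (fst arg) ⟩) ctx
      (enumerate-table ⟨ snd (fst arg) ⟩ ctx {r = rows} refl)
      (λ u → each-table ⟨ itemE ⟩ columns (inRow u) {r = λ j → pair (nat (rank j)) (column u j)} (columns-correct u)
               (λ j → itemE-correct n (table rows) (zeros input) (rows u) (rank u) (rank j) (code u j)))
      (λ u j → cong (encodeTwoTrack ∘ twoTrack ∘ cell) (remQuot-combine u j))

    matrix-correct : matrix input ≡ encodeGraph H
    matrix-correct = each-table (each ⟨ adjacencyE ⟩ ⟨ fst arg ⟩) ⟨ arg ⟩ E {r = labelled} enumerated
      λ i → each-table ⟨ adjacencyE ⟩ ⟨ fst arg ⟩ (pair E (labelled i)) {r = labelled} enumerated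
      λ j → adjacencyE-correct E (rank i) (squares i) (rank j) (squares j)
      where
      E : Val
      E = enumerate items input
      labelled : Fin (n * W) → Val
      labelled i = pair (nat (rank i)) (encoded i)
      enumerated : E ≡ table labelled
      enumerated = enumerate-table items input {r = encoded} items-correct

reduction-correct : ∀ x → let open CliqueInstance x in
  reduction (ParamProblem.encode k-CLIQUE x) ≡
  ParamProblem.encode k-SEPARATING-VERTICES-balanced-2-track (Construction.instanceFor graph k)
reduction-correct x rewrite len-table (λ u → table (λ v → nat (bit (Graph.adj (CliqueInstance.graph x) u v)))) =
  cong₂ pair (cong₂ pair (matrix-correct (nat k)) (items-correct (nat k))) refl
  where
  open CliqueInstance x
  open Construction.Correct graph

-- Cliques and separations

nth : ∀ {n} (p : Subset n) → Fin ∣ p ∣ → Fin n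
nth (outside ∷ p) i       = suc (nth p i)
nth (inside ∷ p)  zero    = zero
nth (inside ∷ p)  (suc i) = suc (nth p i)

nth∈ : ∀ {n} (p : Subset n) i → nth p i ∈ p
nth∈ (outside ∷ p) i       = there (nth∈ p i)
nth∈ (inside ∷ p)  zero    = here
nth∈ (inside ∷ p)  (suc i) = there (nth∈ p i)

nth-injective : ∀ {n} (p : Subset n) {i j} → nth p i ≡ nth p j → i ≡ j
nth-injective (outside ∷ p)                  eq = nth-injective p (suc-injective eq)
nth-injective (inside ∷ p)  {zero}  {zero}   eq = refl
nth-injective (inside ∷ p)  {suc _} {suc _}  eq = cong suc (nth-injective p (suc-injective eq))

index : ∀ {n} {p : Subset n} {x} → x ∈ p → Fin ∣ p ∣
index {p = inside ∷ p}  here        = zero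
index {p = inside ∷ p}  (there x∈p) = suc (index x∈p)
index {p = outside ∷ p} (there x∈p) = index x∈p

index-injective : ∀ {n} {p : Subset n} {x y} (x∈p : x ∈ p) (y∈p : y ∈ p) → index x∈p ≡ index y∈p → x ≡ y
index-injective {p = inside ∷ p}  here        here        eq = refl
index-injective {p = inside ∷ p}  (there x∈p) (there y∈p) eq = cong suc (index-injective x∈p y∈p (suc-injective eq))
index-injective {p = outside ∷ p} (there x∈p) (there y∈p) eq = cong suc (index-injective x∈p y∈p eq)

module _ {n : ℕ} (p : Subset n) {m : ℕ} where

  -- The map may use the proof of membership; `nth∈` fixes one such proof for each element.
  ∣∣-≤ : (f : ∀ {x} → x ∈ p → Fin m) → (∀ {x y} (x∈p : x ∈ p) (y∈p : y ∈ p) → f x∈p ≡ f y∈p → x ≡ y) →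
         ∣ p ∣ ≤ m
  ∣∣-≤ f f-inj = injective⇒≤ {f = λ i → f (nth∈ p i)} λ {i} {j} eq → nth-injective p (f-inj (nth∈ p i) (nth∈ p j) eq)

  -- One extra element sent to the missed value `z` keeps the map injective.
  ∣∣-< : (f : ∀ {x} → x ∈ p → Fin m) → (∀ {x y} (x∈p : x ∈ p) (y∈p : y ∈ p) → f x∈p ≡ f y∈p → x ≡ y) →
         ∀ z → (∀ {x} (x∈p : x ∈ p) → f x∈p ≢ z) → ∣ p ∣ < m
  ∣∣-< f f-inj z f≢z = injective⇒≤ {f = g} g-inj
    where
    g : Fin (suc ∣ p ∣) → Fin m
    g zero    = z
    g (suc i) = f (nth∈ p i)
    g-inj : ∀ {i j} → g i ≡ g j → i ≡ j
    g-inj {zero}  {zero}  eq = refl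
    g-inj {zero}  {suc j} eq = contradiction (sym eq) (f≢z (nth∈ p j))
    g-inj {suc i} {zero}  eq = contradiction eq (f≢z (nth∈ p i))
    g-inj {suc i} {suc j} eq = cong suc (nth-injective p (f-inj (nth∈ p i) (nth∈ p j) eq))

  ∣∣-≥ : (f : Fin m → Fin n) → (∀ i → f i ∈ p) → (∀ {i j} → f i ≡ f j → i ≡ j) → m ≤ ∣ p ∣
  ∣∣-≥ f f∈ f-inj = injective⇒≤ {f = λ i → index (f∈ i)} λ {i} {j} eq → f-inj (index-injective (f∈ i) (f∈ j) eq)

∣p∪q∣≤∣p∣+∣q∣ : ∀ {n} (p q : Subset n) → ∣ p ∪ q ∣ ≤ ∣ p ∣ + ∣ q ∣
∣p∪q∣≤∣p∣+∣q∣ []            []            = z≤n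
∣p∪q∣≤∣p∣+∣q∣ (outside ∷ p) (outside ∷ q) = ∣p∪q∣≤∣p∣+∣q∣ p q
∣p∪q∣≤∣p∣+∣q∣ (outside ∷ p) (inside ∷ q)  = ≤-trans (s≤s (∣p∪q∣≤∣p∣+∣q∣ p q)) (≤-reflexive (sym (+-suc ∣ p ∣ ∣ q ∣)))
∣p∪q∣≤∣p∣+∣q∣ (inside ∷ p)  (outside ∷ q) = s≤s (∣p∪q∣≤∣p∣+∣q∣ p q)
∣p∪q∣≤∣p∣+∣q∣ (inside ∷ p)  (inside ∷ q)  = s≤s (≤-trans (∣p∪q∣≤∣p∣+∣q∣ p q) (+-monoʳ-≤ ∣ p ∣ (n≤1+n ∣ q ∣)))

∈-tabulate⁺ : ∀ {n} (f : Fin n → Bool) {i} → f i ≡ true → i ∈ Vec.tabulate f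
∈-tabulate⁺ f {i} eq = lookup⇒[]= i (Vec.tabulate f) (trans (lookup∘tabulate f i) eq)

∈-tabulate⁻ : ∀ {n} (f : Fin n → Bool) {i} → i ∈ Vec.tabulate f → f i ≡ true
∈-tabulate⁻ f {i} i∈ = trans (sym (lookup∘tabulate f i)) ([]=⇒lookup i∈)

cap≡⊓ : ∀ n k → cap n k ≡ k ⊓ (n + 1)
cap≡⊓ n k with ≤-total k (n + 1)
... | inj₁ p = trans (cong (k ∸_) (m≤n⇒m∸n≡0 p)) (sym (m≤n⇒m⊓n≡m p))
... | inj₂ p = trans (m∸[m∸n]≡n p) (sym (m≥n⇒m⊓n≡n p))

-- If `k` is at least `n + 1`, neither side has a clique, as there are only `n` vertices; otherwise
-- the cap changes nothing.
clique-cap : ∀ {n} (G : Graph n) k → HasClique G k ⇔ HasClique G (cap n k)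
clique-cap {n} G k with ≤-total k (n + 1)
... | inj₁ k≤ = subst (λ κ → HasClique G k ⇔ HasClique G κ) (sym (trans (cap≡⊓ n k) (m≤n⇒m⊓n≡m k≤))) (mk⇔ id id)
... | inj₂ k≥ = subst (λ κ → HasClique G k ⇔ HasClique G κ) (sym (trans (cap≡⊓ n k) (m≥n⇒m⊓n≡n k≥)))
  (mk⇔ (λ c → contradiction c (none k≥)) (λ c → contradiction c (none ≤-refl)))
  where
  none : ∀ {m} → n + 1 ≤ m → ¬ HasClique G m
  none {m} n<m (C , refl , _) = <⇒≱ (≤-trans (≤-reflexive (+-comm 1 n)) n<m) (∣p∣≤n C)

-- Positions of single items

selected-≡1 : ∀ a b c → c ≡ 1 ⊎ a ≡ b → selected a b c ≡ 1
selected-≡1 a b c h =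
  cong bit (from (≤ᵇ≡true 1 (isOne c + isEqual b)) (from (1≤+ (isOne c) (isEqual b)) (positive h)))
  where
  isOne isEqual : ℕ → ℕ
  isOne c   = bit (c ≤ᵇ 1) * bit (1 ≤ᵇ c)
  isEqual b = bit (a ≤ᵇ b) * bit (b ≤ᵇ a)
  positive : c ≡ 1 ⊎ a ≡ b → 1 ≤ isOne c ⊎ 1 ≤ isEqual b
  positive (inj₁ refl) = inj₁ ≤-refl
  positive (inj₂ refl) = inj₂ (from (1≤* (bit (a ≤ᵇ a)) _) (from (1≤bit a a) ≤-refl , from (1≤bit a a) ≤-refl))

selected-≡0 : ∀ a b c → c ≢ 1 → a ≢ b → selected a b c ≡ 0
selected-≡0 a b c c≢1 a≢b with 1 ≤ᵇ bit (c ≤ᵇ 1) * bit (1 ≤ᵇ c) + bit (a ≤ᵇ b) * bit (b ≤ᵇ a) in eq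
... | false = refl
... | true with to (1≤+ _ _) (to (≤ᵇ≡true 1 _) eq)
... | inj₁ p = let q , r = to (1≤* (bit (c ≤ᵇ 1)) _) p in
  contradiction (≤-antisym (to (1≤bit c 1) q) (to (1≤bit 1 c) r)) c≢1
... | inj₂ p = let q , r = to (1≤* (bit (a ≤ᵇ b)) _) p in
  contradiction (≤-antisym (to (1≤bit a b) q) (to (1≤bit b a) r)) a≢b

itemSquare-selected : ∀ n a b c → c ≤ 1 → selected a b c ≡ 1 →
  itemSquare n a b c ≡ square (a * (n + 1) + (1 + b)) (b * (n + 1) + (1 + a)) 0
itemSquare-selected n a b c c≤1 eq rewrite eq =
  trans (cong₂ (λ y z → square (a * (n + 1) + y) z (n * bit (2 ≤ᵇ c))) (*-identityˡ (1 + b)) (*-identityˡ (b * (n + 1) + (1 + a))))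
        (cong (square _ _) (small c c≤1))
  where
  small : ∀ c → c ≤ 1 → n * bit (2 ≤ᵇ c) ≡ 0
  small zero       _ = *-zeroʳ n
  small (suc zero) _ = *-zeroʳ n
  small (suc (suc _)) (s≤s ())

itemSquare-unselected : ∀ n a b c → selected a b c ≡ 0 →
  itemSquare n a b c ≡ square (a * (n + 1)) (a * (n + 1)) (n * bit (2 ≤ᵇ c))
itemSquare-unselected n a b c eq rewrite eq =
  cong₂ (λ x y → square x y (n * bit (2 ≤ᵇ c))) (+-identityʳ (a * (n + 1)))
        (trans (+-identityʳ _) (*-identityˡ (a * (n + 1))))

cell< : ∀ n {a b r} → a < b → r ≤ n → a * (n + 1) + r < b * (n + 1)
cell< n {a} {b} {r} a<b r≤n = begin-strict
  a * (n + 1) + r        <⟨ +-monoʳ-< (a * (n + 1)) (≤-trans (s≤s r≤n) (≤-reflexive (+-comm 1 n))) ⟩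
  a * (n + 1) + (n + 1)  ≡⟨ +-comm (a * (n + 1)) (n + 1) ⟩
  suc a * (n + 1)        ≤⟨ *-monoˡ-≤ (n + 1) a<b ⟩
  b * (n + 1)            ∎
  where open ≤-Reasoning

-- Cells have `n + 1` points and all offsets are at most `n`, so items in different cells cannot
-- meet; within one cell the common corner cancels.
same-cell : ∀ n {a b r s ℓ} → r ≤ n → s + ℓ ≤ n →
  Overlap (a * (n + 1) + r) 0 (b * (n + 1) + s) ℓ → a ≡ b × s ≤ r × r ≤ s + ℓ
same-cell n {a} {b} {r} {s} {ℓ} r≤n s+ℓ≤n (p , q) with <-cmp a b
... | tri< a<b _ _ = contradiction (≤-trans q (≤-reflexive (+-identityʳ _))) (<⇒≱ (≤-trans (cell< n a<b r≤n) (m≤m+n _ s)))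
... | tri> _ _ b<a = contradiction (≤-trans p (≤-reflexive (+-assoc (b * (n + 1)) s ℓ))) (<⇒≱ (≤-trans (cell< n b<a s+ℓ≤n) (m≤m+n _ r)))
... | tri≈ _ refl _ = refl
  , +-cancelˡ-≤ (a * (n + 1)) _ _ (≤-trans q (≤-reflexive (+-identityʳ _)))
  , +-cancelˡ-≤ (a * (n + 1)) _ _ (≤-trans p (≤-reflexive (+-assoc (a * (n + 1)) s ℓ)))

-- The squares of spanning vertices, blockers and arcs

module Hardness {n : ℕ} (G : Graph n) where
  open Graph G using (adj; Adjacent)
  open Construction G

  Compatible : Fin n → Fin n → Set
  Compatible u v = Adjacent u v ⊎ u ≡ v

  compatible? : ∀ u v → Dec (Compatible u v)
  compatible? u v = (adj u v Bool.≟ true) ⊎-dec (u ≟ v)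

  corner : Fin n → ℕ
  corner u = rank u * (n + 1)

  vtx : Fin n → Fin (n * W)
  vtx u = combine u zero

  pad : Fin n → Fin M → Fin (n * W)
  pad u b = combine u (suc (b ↑ˡ n))

  arc : Fin n → Fin n → Fin (n * W)
  arc u v = combine u (suc (M ↑ʳ v))

  vtx-injective : ∀ {u v} → vtx u ≡ vtx v → u ≡ v
  vtx-injective {u} {v} eq = proj₁ (combine-injective u zero v zero eq)

  pad-injective : ∀ u {b c} → pad u b ≡ pad u c → b ≡ c
  pad-injective u eq = ↑ˡ-injective n _ _ (suc-injective (proj₂ (combine-injective u _ u _ eq)))

  arc-injective : ∀ {u v u′ v′} → arc u v ≡ arc u′ v′ → u ≡ u′ × v ≡ v′
  arc-injective {u} {v} {u′} {v′} eq =
    let p , q = combine-injective u _ u′ _ eq in p , ↑ʳ-injective M v v′ (suc-injective q)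

  vtx≢arc : ∀ {u v w} → vtx u ≢ arc v w
  vtx≢arc {u} {v} {w} eq with proj₂ (combine-injective u zero v (suc (M ↑ʳ w)) eq)
  ... | ()

  rank<n : ∀ (u : Fin n) → rank u < n
  rank<n u = toℕ<n (opposite u)

  -- The arcs are the last `n` items of a row. Numbering from the end thus gives them the numbers of
  -- the vertices of `G`, which makes the comparison of row and column in `selected` meaningful.
  rank-arc : ∀ v → rank {W} (suc (M ↑ʳ v)) ≡ rank v
  rank-arc v = begin
    rank {W} (suc (M ↑ʳ v))            ≡⟨ opposite-prop {W} (suc (M ↑ʳ v)) ⟩
    M + n ∸ suc (toℕ (M ↑ʳ v))         ≡⟨ cong (λ t → M + n ∸ suc t) (toℕ-↑ʳ M v) ⟩
    M + n ∸ suc (M + toℕ v)            ≡⟨ cong (M + n ∸_) (+-suc M (toℕ v)) ⟨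
    M + n ∸ (M + suc (toℕ v))          ≡⟨ [m+n]∸[m+o]≡n∸o M n (suc (toℕ v)) ⟩
    n ∸ suc (toℕ v)                    ≡⟨ opposite-prop v ⟨
    rank v                             ∎
    where open ≡-Reasoning

  -- Padding thus never passes the diagonal test of `selected`, row numbers being below `n`. The
  -- spanning vertex, numbered `M + n`, escapes it likewise.
  n≤rank-pad : ∀ b → n ≤ rank {W} (suc (b ↑ˡ n))
  n≤rank-pad b = begin
    n                             ≤⟨ m≤n+m n (M ∸ suc (toℕ b)) ⟩
    M ∸ suc (toℕ b) + n           ≡⟨ +-∸-comm n (toℕ<n b) ⟨
    M + n ∸ suc (toℕ b)           ≡⟨ cong (λ t → M + n ∸ suc t) (toℕ-↑ˡ b n) ⟨
    M + n ∸ suc (toℕ (b ↑ˡ n))    ≡⟨ opposite-prop {W} (suc (b ↑ˡ n)) ⟨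
    rank {W} (suc (b ↑ˡ n))       ∎
    where open ≤-Reasoning

  squares-combine : ∀ u j → squares (combine u j) ≡ itemSquare n (rank u) (rank j) (code u j)
  squares-combine u j = cong cell (remQuot-combine u j)

  squares-vtx : ∀ u → squares (vtx u) ≡ square (corner u) (corner u) n
  squares-vtx u = begin
    squares (vtx u)
      ≡⟨ squares-combine u zero ⟩
    itemSquare n (rank u) (rank {W} zero) 2
      ≡⟨ itemSquare-unselected n (rank u) (rank {W} zero) 2 (selected-≡0 (rank u) (rank {W} zero) 2 (λ ())
           (<⇒≢ (≤-trans (rank<n u) (≤-trans (m≤n+m n M) (≤-reflexive (sym (toℕ-fromℕ (M + n)))))))) ⟩
    square (corner u) (corner u) (n * 1)
      ≡⟨ cong (square (corner u) (corner u)) (*-identityʳ n) ⟩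
    square (corner u) (corner u) n ∎
    where open ≡-Reasoning

  squares-pad : ∀ u b → squares (pad u b) ≡ square (corner u) (corner u) 0
  squares-pad u b = begin
    squares (pad u b)
      ≡⟨ squares-combine u j ⟩
    itemSquare n (rank u) (rank j) (code u j)
      ≡⟨ cong (itemSquare n (rank u) (rank j) ∘ [ (λ _ → 0) , (λ v → bit (adj u v)) ]′) (splitAt-↑ˡ M b n) ⟩
    itemSquare n (rank u) (rank j) 0
      ≡⟨ itemSquare-unselected n (rank u) (rank j) 0 (selected-≡0 (rank u) (rank j) 0 (λ ())
           (<⇒≢ (≤-trans (rank<n u) (n≤rank-pad b)))) ⟩
    square (corner u) (corner u) (n * 0)
      ≡⟨ cong (square (corner u) (corner u)) (*-zeroʳ n) ⟩
    square (corner u) (corner u) 0 ∎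
    where
    open ≡-Reasoning
    j : Fin W
    j = suc (b ↑ˡ n)

  squares-arc : ∀ u v → squares (arc u v) ≡ itemSquare n (rank u) (rank v) (bit (adj u v))
  squares-arc u v = begin
    squares (arc u v)
      ≡⟨ squares-combine u j ⟩
    itemSquare n (rank u) (rank j) (code u j)
      ≡⟨ cong₂ (itemSquare n (rank u)) (rank-arc v) (cong [ (λ _ → 0) , (λ v → bit (adj u v)) ]′ (splitAt-↑ʳ M n v)) ⟩
    itemSquare n (rank u) (rank v) (bit (adj u v)) ∎
    where
    open ≡-Reasoning
    j : Fin W
    j = suc (M ↑ʳ v)

  squares-compatible : ∀ u v → Compatible u v →
    squares (arc u v) ≡ square (corner u + (1 + rank v)) (corner v + (1 + rank u)) 0
  squares-compatible u v c = trans (squares-arc u v)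
    (itemSquare-selected n (rank u) (rank v) (bit (adj u v)) (bit≤1 (adj u v))
      (selected-≡1 (rank u) (rank v) (bit (adj u v)) ([ inj₁ ∘ cong bit , inj₂ ∘ cong rank ]′ c)))
    where
    bit≤1 : ∀ b → bit b ≤ 1
    bit≤1 true  = ≤-refl
    bit≤1 false = z≤n

  -- A pair that is no arc falls back to the corner and acts as one more blocker, so the order of
  -- `H` depends on `n` alone.
  squares-incompatible : ∀ u v → ¬ Compatible u v → squares (arc u v) ≡ square (corner u) (corner u) 0
  squares-incompatible u v ¬c with adj u v | squares-arc u v
  ... | true  | _  = contradiction (inj₁ refl) ¬c
  ... | false | sq = trans sq (trans
    (itemSquare-unselected n (rank u) (rank v) 0 (selected-≡0 (rank u) (rank v) 0 (λ ()) (¬c ∘ inj₂ ∘ rank-injective)))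
    (cong (square (corner u) (corner u)) (*-zeroʳ n)))

  -- Padding and incompatible pairs have the same squares, so `isBlocker` records just the square.
  data Kind (i : Fin (n * W)) : Set where
    isVtx     : ∀ u → i ≡ vtx u → Kind i
    isBlocker : ∀ u → squares i ≡ square (corner u) (corner u) 0 → Kind i
    isArc     : ∀ u v → i ≡ arc u v → Compatible u v → Kind i

  kind : ∀ i → Kind i
  kind i with combine-surjective {n} {W} i
  ... | u , zero  , eq = isVtx u (sym eq)
  ... | u , suc j , eq with splitAt M j in split
  ...   | inj₁ b = isBlocker u (trans (cong squares (trans (sym eq) (cong (combine u ∘ suc) (sym (splitAt⁻¹-↑ˡ split)))))
                                      (squares-pad u b))
  ...   | inj₂ v with i≡ ← trans (sym eq) (cong (combine u ∘ suc) (sym (splitAt⁻¹-↑ʳ split))) | compatible? u v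
  ...     | yes c = isArc u v i≡ c
  ...     | no ¬c = isBlocker u (trans (cong squares i≡) (squares-incompatible u v ¬c))

  touching : ∀ {i j Q Q′} → squares i ≡ Q → squares j ≡ Q′ → Touch Q Q′ → Touch (squares i) (squares j)
  touching refl refl t = t

  ∈-separation : ∀ {X S Y : Subset (n * W)} → X ∪ S ∪ Y ≡ ⊤ →
    (∀ i j → i ∈ X → j ∈ Y → ¬ Graph.Adjacent H i j) →
    ∀ {i j} → i ∈ X → Graph.Adjacent H i j → j ∈ X ⊎ j ∈ S
  ∈-separation {X} {S} {Y} full noEdge {i} {j} i∈X i~j with x∈p∪q⁻ X (S ∪ Y) (subst (j ∈_) (sym full) ∈⊤)
  ... | inj₁ j∈X = inj₁ j∈X
  ... | inj₂ j∈S∪Y with x∈p∪q⁻ S Y j∈S∪Y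
  ...   | inj₁ j∈S = inj₂ j∈S
  ...   | inj₂ j∈Y = contradiction i~j (noEdge i j i∈X j∈Y)

  -- From a separation to a clique

  module FromSeparation {κ : ℕ} (κ≤ : κ ≤ n + 1) {X S : Subset (n * W)}
                        (∣X∣≡ : ∣ X ∣ ≡ κ * κ) (∣S∣≤ : ∣ S ∣ ≤ κ)
                        (closed : ∀ {i j} → i ∈ X → Graph.Adjacent H i j → j ∈ X ⊎ j ∈ S) where

    many : κ * κ + κ < M
    many = begin-strict
      κ * κ + κ                        ≤⟨ +-mono-≤ (*-mono-≤ κ≤ κ≤) κ≤ ⟩
      (n + 1) * (n + 1) + (n + 1)      <⟨ m<m+n _ (s≤s z≤n) ⟩
      (n + 1) * (n + 1) + (n + 1) + suc (n + 1)
        ≡⟨ solve 1 (λ n → (n :+ con 1) :* (n :+ con 1) :+ (n :+ con 1) :+ (con 1 :+ (n :+ con 1))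
                          := (con 2 :+ n) :* (con 2 :+ n)) refl n ⟩
      M ∎
      where open ≤-Reasoning

    -- A vertex of `X` touching the corner is adjacent or equal to each of the `M` blockers there.
    -- By closedness all of them lie in `X ∪ S`, which is too small.
    avoids-corners : ∀ {i} u → i ∈ X → ¬ Touch (squares i) (square (corner u) (corner u) 0)
    avoids-corners {i} u i∈X touches = <⇒≱ many (begin
      M                  ≤⟨ ∣∣-≥ (X ∪ S) (pad u) (λ b → x∈p∪q⁺ (pad∈ b)) (pad-injective u) ⟩
      ∣ X ∪ S ∣          ≤⟨ ∣p∪q∣≤∣p∣+∣q∣ X S ⟩
      ∣ X ∣ + ∣ S ∣      ≤⟨ +-mono-≤ (≤-reflexive ∣X∣≡) ∣S∣≤ ⟩
      κ * κ + κ          ∎)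
      where
      open ≤-Reasoning
      pad∈ : ∀ b → pad u b ∈ X ⊎ pad u b ∈ S
      pad∈ b with i ≟ pad u b
      ... | yes refl = inj₁ i∈X
      ... | no i≢   = closed i∈X (from (adjacent⇔ squares i (pad u b)) (i≢ , touching refl (squares-pad u b) touches))

    vtx∉X : ∀ u → vtx u ∉ X
    vtx∉X u u∈X = avoids-corners u u∈X (touching′ (squares-vtx u) (inj₁ (m≤m+n _ 0 , m≤m+n _ n)))
      where
      touching′ : ∀ {Q Q′ R} → Q ≡ Q′ → Touch Q′ R → Touch Q R
      touching′ refl t = t

    C : Subset n
    C = Vec.tabulate (λ u → lookup S (vtx u))

    ∈C : ∀ {u} → vtx u ∈ X ⊎ vtx u ∈ S → u ∈ C
    ∈C {u} (inj₁ u∈X) = contradiction u∈X (vtx∉X u)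
    ∈C     (inj₂ u∈S) = ∈-tabulate⁺ (λ u → lookup S (vtx u)) ([]=⇒lookup u∈S)

    ∣C∣≤ : ∣ C ∣ ≤ κ
    ∣C∣≤ = ≤-trans (∣∣-≤ C (λ u∈C → index (vtx∈S u∈C))
                     (λ u∈C v∈C eq → vtx-injective (index-injective (vtx∈S u∈C) (vtx∈S v∈C) eq))) ∣S∣≤
      where
      vtx∈S : ∀ {u} → u ∈ C → vtx u ∈ S
      vtx∈S {u} u∈C = lookup⇒[]= (vtx u) S (∈-tabulate⁻ (λ u → lookup S (vtx u)) u∈C)

    record ArcIn (i : Fin (n * W)) : Set where
      field
        {source target} : Fin n
        isArcᵢ     : i ≡ arc source target
        compatible : Compatible source target
        source∈C   : source ∈ C
        target∈C   : target ∈ C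

    open ArcIn

    -- Only arcs remain once corners are avoided. On the first track an arc lies in the cell of its
    -- source and on the second in that of its target, so it touches both spanning vertices; these
    -- are outside `X`, hence in `S`.
    arcIn : ∀ {i} → i ∈ X → ArcIn i
    arcIn {i} i∈X with kind i
    ... | isVtx u refl     = contradiction i∈X (vtx∉X u)
    ... | isBlocker u sq   = contradiction (inj₁ (m≤m+n _ 0 , m≤m+n _ 0))
                               (subst (λ Q → ¬ Touch Q (square (corner u) (corner u) 0)) sq (avoids-corners u i∈X))
    ... | isArc u v refl c = record
      { isArcᵢ     = refl
      ; compatible = c
      ; source∈C   = ∈C (closed i∈X (from (adjacent⇔ squares (arc u v) (vtx u)) (vtx≢arc ∘ sym ,
          touching (squares-compatible u v c) (squares-vtx u)
            (inj₁ (inCell u v , ≤-trans (m≤m+n _ _) (m≤m+n _ 0))))))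
      ; target∈C   = ∈C (closed i∈X (from (adjacent⇔ squares (arc u v) (vtx v)) (vtx≢arc ∘ sym ,
          touching (squares-compatible u v c) (squares-vtx v)
            (inj₂ (inCell v u , ≤-trans (m≤m+n _ _) (m≤m+n _ 0))))))
      }
      where
      inCell : ∀ u v → corner u + (1 + rank v) ≤ corner u + n
      inCell u v = +-monoʳ-≤ (corner u) (rank<n v)

    pairIndex : ∀ {i} → i ∈ X → Fin (∣ C ∣ * ∣ C ∣)
    pairIndex i∈X = combine (index (source∈C (arcIn i∈X))) (index (target∈C (arcIn i∈X)))

    pairIndex-injective : ∀ {i j} (i∈X : i ∈ X) (j∈X : j ∈ X) → pairIndex i∈X ≡ pairIndex j∈X → i ≡ j
    pairIndex-injective i∈X j∈X eq with combine-injective _ _ _ _ eq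
    ... | p , q = trans (isArcᵢ (arcIn i∈X)) (trans
      (cong₂ arc (index-injective (source∈C (arcIn i∈X)) (source∈C (arcIn j∈X)) p)
                 (index-injective (target∈C (arcIn i∈X)) (target∈C (arcIn j∈X)) q))
      (sym (isArcᵢ (arcIn j∈X))))

    -- `X` injects into `C × C` by endpoints, so a smaller `C` would leave `X` with fewer than
    -- `κ * κ` elements.
    ∣C∣≡ : ∣ C ∣ ≡ κ
    ∣C∣≡ with m≤n⇒m<n∨m≡n ∣C∣≤
    ... | inj₂ eq = eq
    ... | inj₁ lt = contradiction (∣∣-≤ X pairIndex pairIndex-injective)
                      (<⇒≱ (subst (∣ C ∣ * ∣ C ∣ <_) (sym ∣X∣≡) (*-mono-< lt lt)))

    -- X has as many elements as C × C has pairs, so every pair occurs as an arc in X.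
    adjacent : ∀ u v → u ∈ C → v ∈ C → u ≢ v → Adjacent u v
    adjacent u v u∈C v∈C u≢v with compatible? u v
    ... | yes (inj₁ u~v) = u~v
    ... | yes (inj₂ u≡v) = contradiction u≡v u≢v
    ... | no ¬c = contradiction (∣∣-< X pairIndex pairIndex-injective (combine (index u∈C) (index v∈C)) missed)
                    (<-irrefl (trans ∣X∣≡ (sym (cong₂ _*_ ∣C∣≡ ∣C∣≡))))
      where
      missed : ∀ {i} (i∈X : i ∈ X) → pairIndex i∈X ≢ combine (index u∈C) (index v∈C)
      missed i∈X eq with combine-injective _ _ _ _ eq
      ... | p , q = ¬c (subst₂ Compatible (index-injective (source∈C (arcIn i∈X)) u∈C p)
                                          (index-injective (target∈C (arcIn i∈X)) v∈C q)
                                          (compatible (arcIn i∈X)))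

    clique : HasClique G κ
    clique = C , ∣C∣≡ , adjacent

  -- Used with `ℓ = n`, this says that an arc meets only the spanning vertices of its own endpoints;
  -- with `ℓ = 0` the offset bound is absurd, so arcs miss blockers.
  at-corner : ∀ {u v w ℓ} → ℓ ≤ n → Overlap (corner u + (1 + rank v)) 0 (corner w) ℓ → u ≡ w × 1 + rank v ≤ ℓ
  at-corner {u} {v} {w} {ℓ} ℓ≤n o =
    let p , _ , q = same-cell n {s = 0} (rank<n v) ℓ≤n
                      (subst (λ c → Overlap (corner u + (1 + rank v)) 0 c ℓ) (sym (+-identityʳ (corner w))) o)
    in rank-injective p , q

  same-point : ∀ {u v w x} → Overlap (corner u + (1 + rank v)) 0 (corner w + (1 + rank x)) 0 → u ≡ w × v ≡ x
  same-point {v = v} {x = x} o =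
    let p , q , r = same-cell n (rank<n v) (≤-trans (≤-reflexive (+-identityʳ _)) (rank<n x)) o
    in rank-injective p
     , rank-injective (ℕ.suc-injective (≤-antisym (≤-trans r (≤-reflexive (+-identityʳ _))) q))

  -- From a clique to a separation

  module FromClique {C : Subset n} (clique : ∀ u v → u ∈ C → v ∈ C → u ≢ v → Adjacent u v) where

    κ : ℕ
    κ = ∣ C ∣

    inX inS : Fin n × Fin W → Bool
    inX (u , zero)  = false
    inX (u , suc j) = [ (λ _ → false) , (λ v → lookup C u ∧ lookup C v) ]′ (splitAt M j)
    inS (u , zero)  = lookup C u
    inS (u , suc j) = false

    X S Y : Subset (n * W)
    X = Vec.tabulate (inX ∘ remQuot W)
    S = Vec.tabulate (inS ∘ remQuot W)
    Y = ∁ (X ∪ S)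

    lookup⇒∈ : ∀ {u} → lookup C u ≡ true → u ∈ C
    lookup⇒∈ {u} = lookup⇒[]= u C

    arc∈X : ∀ {u v} → u ∈ C → v ∈ C → arc u v ∈ X
    arc∈X {u} {v} u∈C v∈C = ∈-tabulate⁺ (inX ∘ remQuot W) (begin
      inX (remQuot W (arc u v))    ≡⟨ cong inX (remQuot-combine u (suc (M ↑ʳ v))) ⟩
      inX (u , suc (M ↑ʳ v))       ≡⟨ cong [ (λ _ → false) , (λ v → lookup C u ∧ lookup C v) ]′ (splitAt-↑ʳ M n v) ⟩
      lookup C u ∧ lookup C v      ≡⟨ cong₂ _∧_ ([]=⇒lookup u∈C) ([]=⇒lookup v∈C) ⟩
      true                         ∎)
      where open ≡-Reasoning

    vtx∈S : ∀ {u} → u ∈ C → vtx u ∈ S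
    vtx∈S {u} u∈C = ∈-tabulate⁺ (inS ∘ remQuot W)
      (trans (cong inS (remQuot-combine {n} {W} u zero)) ([]=⇒lookup u∈C))

    record ArcOfC (i : Fin (n * W)) : Set where
      field
        {source target} : Fin n
        isArcᵢ   : i ≡ arc source target
        source∈C : source ∈ C
        target∈C : target ∈ C

    open ArcOfC

    X-arc : ∀ {i} → i ∈ X → ArcOfC i
    X-arc {i} i∈X with combine-surjective {n} {W} i | ∈-tabulate⁻ (inX ∘ remQuot W) i∈X
    -- Transport along `remQuot-combine` lets `inX` compute on `(u , j)`; the items where it is
    -- `false` then drop out.
    ... | u , j , refl | eq with trans (cong inX (sym (remQuot-combine u j))) eq
    X-arc i∈X | u , suc j , refl | _ | eq with splitAt M j in split
    ... | inj₂ v with lookup C u in u∈ | lookup C v in v∈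
    ...   | true | true = record
      { isArcᵢ   = cong (combine u ∘ suc) (sym (splitAt⁻¹-↑ʳ split))
      ; source∈C = lookup⇒∈ u∈
      ; target∈C = lookup⇒∈ v∈
      }

    S-vtx : ∀ {i} → i ∈ S → ∃[ u ] i ≡ vtx u × u ∈ C
    S-vtx {i} i∈S with combine-surjective {n} {W} i | ∈-tabulate⁻ (inS ∘ remQuot W) i∈S
    ... | u , j , refl | eq with trans (cong inS (sym (remQuot-combine u j))) eq
    S-vtx i∈S | u , zero , refl | _ | eq = u , refl , lookup⇒∈ eq

    ∣S∣≤ : ∣ S ∣ ≤ κ
    ∣S∣≤ = ∣∣-≤ S (λ i∈S → index (proj₂ (proj₂ (S-vtx i∈S)))) λ i∈S j∈S eq →
      let u , i≡ , u∈C = S-vtx i∈S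
          v , j≡ , v∈C = S-vtx j∈S
      in trans i≡ (trans (cong vtx (index-injective u∈C v∈C eq)) (sym j≡))

    pairIndex : ∀ {i} → i ∈ X → Fin (κ * κ)
    pairIndex i∈X = combine (index (source∈C (X-arc i∈X))) (index (target∈C (X-arc i∈X)))

    pairIndex-injective : ∀ {i j} (i∈X : i ∈ X) (j∈X : j ∈ X) → pairIndex i∈X ≡ pairIndex j∈X → i ≡ j
    pairIndex-injective i∈X j∈X eq with combine-injective _ _ _ _ eq
    ... | p , q = trans (isArcᵢ (X-arc i∈X)) (trans
      (cong₂ arc (index-injective (source∈C (X-arc i∈X)) (source∈C (X-arc j∈X)) p)
                 (index-injective (target∈C (X-arc i∈X)) (target∈C (X-arc j∈X)) q))
      (sym (isArcᵢ (X-arc j∈X))))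

    arcAt : Fin κ × Fin κ → Fin (n * W)
    arcAt (a , b) = arc (nth C a) (nth C b)

    arcAt-injective : ∀ {p q} → arcAt p ≡ arcAt q → p ≡ q
    arcAt-injective eq with arc-injective eq
    ... | p , q = cong₂ _,_ (nth-injective C p) (nth-injective C q)

    remQuot-injective : ∀ {p q : Fin (κ * κ)} → remQuot {κ} κ p ≡ remQuot κ q → p ≡ q
    remQuot-injective {p} {q} eq =
      trans (sym (combine-remQuot {κ} κ p)) (trans (cong (uncurry combine) eq) (combine-remQuot {κ} κ q))

    ∣X∣≡ : ∣ X ∣ ≡ κ * κ
    ∣X∣≡ = ≤-antisym
      (∣∣-≤ X pairIndex pairIndex-injective)
      (∣∣-≥ X (arcAt ∘ remQuot κ) (λ p → arc∈X (nth∈ C _) (nth∈ C _))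
            (λ eq → remQuot-injective (arcAt-injective eq)))

    compatible : ∀ {u v} → u ∈ C → v ∈ C → Compatible u v
    compatible {u} {v} u∈C v∈C with u ≟ v
    ... | yes u≡v = inj₂ u≡v
    ... | no u≢v  = inj₁ (clique u v u∈C v∈C u≢v)

    -- A spanning vertex met by an arc of `X` belongs to one of its endpoints and so lies in `S`.
    -- Blockers are never met, and another arc would share a point with it on some track and hence
    -- be the same arc.
    neighbour : ∀ {i j} → i ∈ X → Graph.Adjacent H i j → j ∈ S
    neighbour {i} {j} i∈X i~j with X-arc i∈X
    ... | record { source = u ; target = v ; isArcᵢ = refl ; source∈C = u∈C ; target∈C = v∈C }
      with to (adjacent⇔ squares (arc u v) j) i~j | squares-compatible u v (compatible u∈C v∈C)
    ...   | i≢j , touches | square-i with kind j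
    ...     | isVtx w refl with subst₂ Touch square-i (squares-vtx w) touches
    ...       | inj₁ o = subst (λ w → vtx w ∈ S) (proj₁ (at-corner ≤-refl o)) (vtx∈S u∈C)
    ...       | inj₂ o = subst (λ w → vtx w ∈ S) (proj₁ (at-corner ≤-refl o)) (vtx∈S v∈C)
    neighbour i∈X i~j | _ | i≢j , touches | square-i | isBlocker w square-j
      with subst₂ Touch square-i square-j touches
    ...       | inj₁ o = contradiction (proj₂ (at-corner z≤n o)) λ ()
    ...       | inj₂ o = contradiction (proj₂ (at-corner z≤n o)) λ ()
    neighbour i∈X i~j | _ | i≢j , touches | square-i | isArc w x refl c
      with subst₂ Touch square-i (squares-compatible w x c) touches
    ...       | inj₁ o = let u≡w , v≡x = same-point o in contradiction (cong₂ arc u≡w v≡x) i≢j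
    ...       | inj₂ o = let v≡x , u≡w = same-point o in contradiction (cong₂ arc u≡w v≡x) i≢j

    separation : HasSeparation H κ (κ * κ)
    separation = X , S , Y
      , trans (sym (∪-assoc X S Y)) (p∪∁p≡⊤ (X ∪ S))
      , (λ (i , i∈) → let i∈X , i∈S = x∈p∩q⁻ X S i∈
                          _ , i≡vtx , _ = S-vtx i∈S
                      in vtx≢arc (trans (sym i≡vtx) (isArcᵢ (X-arc i∈X))))
      , (λ (i , i∈) → let i∈X , i∈Y = x∈p∩q⁻ X Y i∈ in x∈∁p⇒x∉p i∈Y (x∈p∪q⁺ (inj₁ i∈X)))
      , (λ (i , i∈) → let i∈S , i∈Y = x∈p∩q⁻ S Y i∈ in x∈∁p⇒x∉p i∈Y (x∈p∪q⁺ (inj₂ i∈S)))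
      , ∣X∣≡ , ∣S∣≤
      , (λ i j i∈X j∈Y i~j → x∈∁p⇒x∉p j∈Y (x∈p∪q⁺ {p = X} (inj₂ (neighbour i∈X i~j))))

  equivalence : ∀ k → HasClique G k ⇔ HasSeparation H (cap n k) (cap n k * cap n k)
  equivalence k = mk⇔
    (λ c → forward (to (clique-cap G k) c))
    (λ (X , S , Y , full , _ , _ , _ , ∣X∣≡ , ∣S∣≤ , noEdge) → from (clique-cap G k)
      (FromSeparation.clique (≤-trans (≤-reflexive (cap≡⊓ n k)) (m⊓n≤n k (n + 1)))
                             ∣X∣≡ ∣S∣≤ (∈-separation full noEdge)))
    where
    forward : ∀ {κ} → HasClique G κ → HasSeparation H κ (κ * κ)
    forward (C , refl , clique) = FromClique.separation clique

-- Assembling the reduction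

single : Expr 1 → Program
single e = record { registers-1 = 0 ; body = zero ≔ e }

theorem12 : W[1]-hard k-SEPARATING-VERTICES-balanced-2-track
theorem12 = record
  { program      = record { registers-1 = 1 ; body = command reductionₚ }
  ; g            = λ _ → 1
  ; g-computable = single (const 1) , λ _ → _ , _ , ⇓-assign , refl
  -- The time is bounded in terms of `2 + (size x + 1)`, where the last 1 is the size of the initial
  -- stack `nat 0`. As `size x` is at least 3, its square dominates this sum, which doubles the
  -- degree.
  ; exponent     = 2 * degree
  -- A single bound has to serve both new parameters, the capped `k` and its square.
  ; f            = λ ks → Vec.head ks + Vec.head ks * Vec.head ks
  ; f-computable = single (add (fst arg) (mul (fst arg) (fst arg)))
                 , λ { (k ∷ []) → _ , _ , ⇓-assign , refl }
  ; reduces      = λ x → let open CliqueInstance x in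
      Construction.instanceFor graph k
      , (_ , (_ , runs reductionₚ (encode x , nat 0) , reduction-correct x) , time≤ x)
      , capped≤ order k ∷ capped²≤ order k ∷ []
      , Hardness.equivalence graph k
  }
  where
  open ParamProblem k-CLIQUE using (encode; size)
  open _≼_ (time-≼ reductionₚ) using (degree; bound)

  cap≤ : ∀ n k → cap n k ≤ k
  cap≤ n k = m∸n≤m k (k ∸ (n + 1))

  capped≤ : ∀ n k → cap n k ≤ k + k * k
  capped≤ n k = ≤-trans (cap≤ n k) (m≤m+n k (k * k))

  capped²≤ : ∀ n k → cap n k * cap n k ≤ k + k * k
  capped²≤ n k = ≤-trans (*-mono-≤ (cap≤ n k) (cap≤ n k)) (m≤n+m (k * k) k)

  square≥ : ∀ s → 3 ≤ s → 2 + (s + 1) ≤ s ^ 2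
  square≥ s 3≤s = begin
    2 + (s + 1)    ≡⟨ solve 1 (λ s → con 2 :+ (s :+ con 1) := con 3 :+ s) refl s ⟩
    3 + s          ≤⟨ +-monoˡ-≤ s 3≤s ⟩
    s + s          ≡⟨ cong (s +_) (+-identityʳ s) ⟨
    2 * s          ≤⟨ *-monoˡ-≤ s (≤-trans (n≤1+n 2) 3≤s) ⟩
    s * s          ≡⟨ cong (s *_) (*-identityʳ s) ⟨
    s ^ 2          ∎
    where open ≤-Reasoning

  time≤ : ∀ x → time reductionₚ (encode x , nat 0) ≤ 1 * size x ^ (2 * degree)
  time≤ x = begin
    time reductionₚ (encode x , nat 0)  ≤⟨ bound (encode x , nat 0) ⟩
    (2 + (size x + 1)) ^ degree         ≤⟨ ^-monoˡ-≤ degree (square≥ (size x) (s≤s (+-mono-≤ 1≤‖ encodeGraph graph ‖ 1≤‖ nat k ‖))) ⟩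
    (size x ^ 2) ^ degree               ≡⟨ ^-*-assoc (size x) 2 degree ⟩
    size x ^ (2 * degree)               ≡⟨ *-identityˡ _ ⟨
    1 * size x ^ (2 * degree)           ∎
    where
    open ≤-Reasoning
    open CliqueInstance x
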